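{- Let $p\ge2$ be an integer, $r\in\{0,\dots,p-1\}$, $f:\mathbb{Z}_p\to\mathbb{Z}_p$ a function, and $g=\sum_{i=0}^da_ix^i\in\mathbb{Q}_p[x]$ (with the convention $0^0:=1$) a polynomial with $g(r+p\mathbb{Z}_p)\subseteq\mathbb{Z}_p$ and $f(n)=g(n)$ for all $n\in r+p\mathbb{Z}_p$. Let $k\ge0$ be an integer, put $W_\ell:=\{0,\dots,p^\ell-1\}\cap(r+p\mathbb{Z}_p)$ for all integers $\ell\ge0$, and $K:=-\min\big(\{\nu_p(a_i)\mid 0\le i\le d\}\cup\{0\}\big)$. Write $\tilde f(n):=f(n)-(f(n)\,\%\,p)$. Then $W_{K+k}$ is a finite witness set for $f$ being (weakly) $(p,r)$-suitable at $k$, i.e.: (1) $f$ is weakly $(p,r)$-suitable at $k$ if and only if for all $m,n\in W_{K+k}$: $m\equiv n\pmod{p^k}\Rightarrow\tilde f(m)\equiv\tilde f(n)\pmod{p^k}$. (2) $f$ is $(p,r)$-suitable at $k$ if and only if for all $m,n\in W_{K+k}$: $m\equiv n\pmod{p^k}\Leftrightarrow\tilde f(m)\equiv\tilde f(n)\pmod{p^k}$. Furthermore: (3) For all integers $\ell\ge K+1$: if $f$ is weakly $(p,r)$-suitable at $\ell$, then it is weakly $(p,r)$-suitable at $\ell+1$. In particular, $f$ is weakly $(p,r)$-suitable at $\{\ell\in\mathbb{Z}\mid\ell\ge K+1\}$ if and only if it is weakly $(p,r)$-suitable at $K+1$. (4) For all integers $\ell\ge K+2$: if $f$ is weakly $(p,r)$-suitable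 at $\ell$ and $(p,r)$-suitable at $\ell+1$, then it is $(p,r)$-suitable at $\ell+2$. In particular, $f$ is $(p,r)$-suitable at $\{\ell\in\mathbb{Z}\mid\ell\ge K+2\}$ if and only if it is $(p,r)$-suitable at $\{K+2,K+3\}$. In particular: (1') $f$ is weakly $(p,r)$-suitable if and only if it is weakly $(p,r)$-suitable at $\{0,\dots,K+1\}$, if and only if for all $\ell\in\{0,\dots,K+1\}$ and all $m,n\in W_{K+\ell}$: $m\equiv n\pmod{p^\ell}\Rightarrow\tilde f(m)\equiv\tilde f(n)\pmod{p^\ell}$. (2') $f$ is $(p,r)$-suitable if and only if it is $(p,r)$-suitable at $\{0,\dots,K+3\}$, if and only if for all $\ell\in\{0,\dots,K+3\}$ and all $m,n\in W_{K+\ell}$: $m\equiv n\pmod{p^\ell}\Leftrightarrow\tilde f(m)\equiv\tilde f(n)\pmod{p^\ell}$.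
   Context: $p\ge2$ is an integer, not necessarily prime. $\mathbb{Z}_p=\varprojlim \mathbb{Z}/p^k\mathbb{Z}$; every $a\in\mathbb{Z}_p$ is uniquely $a=\sum_{i\ge0}a_ip^i$ with $a_i\in\{0,\dots,p-1\}$, and $a\,\%\,p:=a_0$. $\mathbb{Q}_p=\mathbb{Z}_p[1/p]$. For $x\in\mathbb{Q}_p$: $\nu_p(x)=\max\{k\in\mathbb{N}_0\mid x/p^k\in\mathbb{Z}_p\}$ if $x\in\mathbb{Z}_p\setminus\{0\}$, $\nu_p(x)=-\min\{k\in\mathbb{N}\mid xp^k\in\mathbb{Z}_p\}$ if $x\in\mathbb{Q}_p\setminus\mathbb{Z}_p$, and $\nu_p(0)=\infty$. For a set $L$ of nonnegative integers, a function $f:\mathbb{Z}_p\to\mathbb{Z}_p$ is weakly $(p,r)$-suitable at $L$ if for all $\ell\in L$ and all $m,n\in r+p\mathbb{Z}_p$: $m\equiv n\pmod{p^\ell}$ implies $f(m)-(f(m)\%p)\equiv f(n)-(f(n)\%p)\pmod{p^\ell}$; it is $(p,r)$-suitable at $L$ if this implication is an equivalence for all such $\ell,m,n$. "At $\ell$" means $L=\{\ell\}$; without specification $L=\mathbb{N}_0$. -}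

module Defs where

open import Level using (0ℓ)
open import Algebra.Bundles using (CommutativeRing)
open import Data.Fin.Base using (toℕ)
open import Data.Integer.Base as ℤ using (ℤ; +_; -[1+_]; 0ℤ; 1ℤ)
import Data.Integer.Properties as ℤ
import Data.Integer.Divisibility.Signed as ℤ∣
open ℤ∣ using (divides)
import Data.Integer.DivMod as ℤ
import Data.Integer.Tactic.RingSolver as ℤ-Solver
open import Data.Nat.Base as ℕ using (ℕ; zero; suc; NonZero; NonTrivial)
import Data.Nat.DivMod as ℕ
import Data.Nat.Properties as ℕ
open import Data.Product.Base using (∃; _×_; _,_)
open import Data.Vec.Functional using (Vector)
open import Function.Bundles using (_⟶ₛ_; _⇔_; _⟨$⟩_)
open import Relation.Binary.Bundles using (Setoid)
open import Relation.Binary.Core using (Rel)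
open import Relation.Binary.PropositionalEquality.Core as ≡ using (_≡_; refl; cong; subst)
open import Relation.Binary.Construct.Add.Supremum.NonStrict ℤ._≤_ using (_≤⁺_)
open import Relation.Nullary.Construct.Add.Supremum using (_⁺; [_]; ⊤⁺)
open import Relation.Nullary.Negation.Core using (¬_)
open import Relation.Unary using (Pred; _∈_; _∉_; _∪_; _∩_; ｛_｝; U)

module _ {a ℓ ℓ′} {A : Set a} (_≤_ : Rel A ℓ) (P : Pred A ℓ′) where

  IsLeast : A → Set _
  IsLeast x = x ∈ P × (∀ {y} → y ∈ P → x ≤ y)

  IsGreatest : A → Set _
  IsGreatest x = x ∈ P × (∀ {y} → y ∈ P → y ≤ x)

------------------------------------------------------------------------
-- The rings ℤ/n, with carrier ℤ and congruence as equality

infix 4 _≡_[mod_]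

record _≡_[mod_] (a b : ℤ) (n : ℕ) : Set where
  constructor mk-mod
  field
    n∣a-b : + n ℤ∣.∣ a ℤ.- b

open _≡_[mod_]

private
  module ModIdentities where
    sym-lem : ∀ a b → ℤ.- (a ℤ.- b) ≡ b ℤ.- a
    sym-lem = ℤ-Solver.solve-∀

    trans-lem : ∀ a b c → (a ℤ.- b) ℤ.+ (b ℤ.- c) ≡ a ℤ.- c
    trans-lem = ℤ-Solver.solve-∀

    +-lem : ∀ a b c d → (a ℤ.- b) ℤ.+ (c ℤ.- d) ≡ (a ℤ.+ c) ℤ.- (b ℤ.+ d)
    +-lem = ℤ-Solver.solve-∀

    *-lem : ∀ a b c d → (a ℤ.- b) ℤ.* c ℤ.+ (c ℤ.- d) ℤ.* b ≡ (a ℤ.* c) ℤ.- (b ℤ.* d)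
    *-lem = ℤ-Solver.solve-∀

    neg-lem : ∀ a b → ℤ.- (a ℤ.- b) ≡ (ℤ.- a) ℤ.- (ℤ.- b)
    neg-lem = ℤ-Solver.solve-∀

    cancel-lem₁ : ∀ M a b → M ℤ.* (a ℤ.- b) ≡ M ℤ.* a ℤ.- M ℤ.* b
    cancel-lem₁ = ℤ-Solver.solve-∀

    cancel-lem₂ : ∀ M N q → q ℤ.* (M ℤ.* N) ≡ M ℤ.* (q ℤ.* N)
    cancel-lem₂ = ℤ-Solver.solve-∀

    sub-lem : ∀ r m → (r ℤ.+ m) ℤ.- r ≡ m
    sub-lem = ℤ-Solver.solve-∀

    sub-lem₂ : ∀ a b → a ≡ b ℤ.+ (a ℤ.- b)
    sub-lem₂ = ℤ-Solver.solve-∀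

    sub-lem₃ : ∀ a b → b ≡ a ℤ.+ ℤ.- (a ℤ.- b)
    sub-lem₃ = ℤ-Solver.solve-∀

  open ModIdentities

module _ {n : ℕ} where
  private
    by : ∀ {x a b} → x ≡ a ℤ.- b → + n ℤ∣.∣ x → a ≡ b [mod n ]
    by e d = mk-mod (subst (+ n ℤ∣.∣_) e d)

    ∣-neg : ∀ {x} → + n ℤ∣.∣ x → + n ℤ∣.∣ ℤ.- x
    ∣-neg (divides q e) = divides (ℤ.- q) (≡.trans (cong ℤ.-_ e) (ℤ.neg-distribˡ-* q (+ n)))

  mod-reflexive : ∀ {a b} → a ≡ b → a ≡ b [mod n ]
  mod-reflexive {a} refl = mk-mod (divides 0ℤ (ℤ.+-inverseʳ a))

  mod-sym : ∀ {a b} → a ≡ b [mod n ] → b ≡ a [mod n ]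
  mod-sym {a} {b} (mk-mod p) = by (sym-lem a b) (∣-neg p)

  mod-trans : ∀ {a b c} → a ≡ b [mod n ] → b ≡ c [mod n ] → a ≡ c [mod n ]
  mod-trans {a} {b} {c} (mk-mod p) (mk-mod q) = by (trans-lem a b c) (ℤ∣.∣m∣n⇒∣m+n p q)

  mod-+ : ∀ {a b c d} → a ≡ b [mod n ] → c ≡ d [mod n ] → a ℤ.+ c ≡ b ℤ.+ d [mod n ]
  mod-+ {a} {b} {c} {d} (mk-mod p) (mk-mod q) = by (+-lem a b c d) (ℤ∣.∣m∣n⇒∣m+n p q)

  mod-* : ∀ {a b c d} → a ≡ b [mod n ] → c ≡ d [mod n ] → a ℤ.* c ≡ b ℤ.* d [mod n ]
  mod-* {a} {b} {c} {d} (mk-mod p) (mk-mod q) =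
    by (*-lem a b c d) (ℤ∣.∣m∣n⇒∣m+n (ℤ∣.∣m⇒∣m*n c p) (ℤ∣.∣m⇒∣m*n b q))

  mod-neg : ∀ {a b} → a ≡ b [mod n ] → ℤ.- a ≡ ℤ.- b [mod n ]
  mod-neg {a} {b} (mk-mod p) = by (neg-lem a b) (∣-neg p)

mod-cancel : ∀ m n .{{_ : NonZero m}} {a b} →
             + m ℤ.* a ≡ + m ℤ.* b [mod m ℕ.* n ] → a ≡ b [mod n ]
mod-cancel m@(suc _) n {a} {b} (mk-mod (divides q e)) = mk-mod (divides q
  (ℤ.*-cancelˡ-≡ (+ m) (a ℤ.- b) (q ℤ.* + n)
    (≡.trans (cancel-lem₁ (+ m) a b)
    (≡.trans e
    (≡.trans (cong (q ℤ.*_) (ℤ.pos-* m n)) (cancel-lem₂ (+ m) (+ n) q))))))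

mod-weaken : ∀ m n {a b} → a ≡ b [mod m ℕ.* n ] → a ≡ b [mod n ]
mod-weaken m n (mk-mod d) = mk-mod (ℤ∣.∣-trans (divides (+ m) (ℤ.pos-* m n)) d)

mod-%ℕ : ∀ a n .{{_ : NonZero n}} → a ≡ + (a ℤ.%ℕ n) [mod n ]
mod-%ℕ a n = mk-mod (divides (a ℤ./ℕ n)
  (≡.trans (cong (ℤ._- + (a ℤ.%ℕ n)) (ℤ.a≡a%ℕn+[a/ℕn]*n a n))
           (sub-lem (+ (a ℤ.%ℕ n)) (a ℤ./ℕ n ℤ.* + n))))

%-unique : ∀ n .{{_ : NonZero n}} {a b} → + a ≡ + b [mod n ] → b ℕ.< n → a ℕ.% n ≡ b
%-unique n {a} {b} (mk-mod (divides (+ q) e)) b<n =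
  ≡.trans (cong (ℕ._% n) a≡) (≡.trans (ℕ.[m+kn]%n≡m%n b q n) (ℕ.m<n⇒m%n≡m b<n))
  where
  a≡ : a ≡ b ℕ.+ q ℕ.* n
  a≡ = ℤ.+-injective (≡.trans (sub-lem₂ (+ a) (+ b)) (cong (λ z → + b ℤ.+ z) (≡.trans e (≡.sym (ℤ.pos-* q n)))))
%-unique n {a} {b} (mk-mod (divides q@(-[1+ q′ ]) e)) b<n =
  ≡.trans (≡.sym (ℕ.[m+kn]%n≡m%n a (suc q′) n)) (≡.trans (cong (ℕ._% n) (≡.sym b≡)) (ℕ.m<n⇒m%n≡m b<n))
  where
  b≡ : b ≡ a ℕ.+ suc q′ ℕ.* n
  b≡ = ℤ.+-injective (≡.trans (sub-lem₃ (+ a) (+ b)) (cong (λ z → + a ℤ.+ z)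
    (≡.trans (cong ℤ.-_ e) (≡.trans (ℤ.neg-distribˡ-* q (+ n)) (≡.sym (ℤ.pos-* (suc q′) n))))))

private module RingIdentities {c ℓ} (R : CommutativeRing c ℓ) where
  open CommutativeRing R using (_≈_; _+_; _*_; commutativeSemiring) renaming (refl to ≈-refl)
  open import Algebra.Solver.Ring.NaturalCoefficients.Default commutativeSemiring

  left-swap : ∀ x y z → y * (x * z) ≈ x * (y * z)
  left-swap = solve 3 (λ x y z → y :* (x :* z) := x :* (y :* z)) ≈-refl

  right-swap : ∀ x y z → x * y * z ≈ x * z * y
  right-swap = solve 3 (λ x y z → x :* y :* z := x :* z :* y) ≈-refl

  interchange : ∀ a b K L → a * b * (K * L) ≈ (a * K) * (b * L)
  interchange = solve 4 (λ a b K L → a :* b :* (K :* L) := (a :* K) :* (b :* L)) ≈-refl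

  +-cong-lem : ∀ a b K L K′ L′ →
    (a * L + b * K) * (K′ * L′) ≈ (a * K′) * (L * L′) + (b * L′) * (K * K′)
  +-cong-lem = solve 6 (λ a b K L K′ L′ →
    (a :* L :+ b :* K) :* (K′ :* L′) := (a :* K′) :* (L :* L′) :+ (b :* L′) :* (K :* K′)) ≈-refl

  +-cong-lem′ : ∀ a b K L K′ L′ →
    (a * K) * (L * L′) + (b * L) * (K * K′) ≈ (a * L′ + b * K′) * (K * L)
  +-cong-lem′ = solve 6 (λ a b K L K′ L′ →
    (a :* K) :* (L :* L′) :+ (b :* L) :* (K :* K′) := (a :* L′ :+ b :* K′) :* (K :* L)) ≈-refl

  +-assoc-lem : ∀ a b c K L M →
    (a * L + b * K) * M + c * (K * L) ≈ a * (L * M) + (b * M + c * L) * K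
  +-assoc-lem = solve 6 (λ a b c K L M →
    (a :* L :+ b :* K) :* M :+ c :* (K :* L) := a :* (L :* M) :+ (b :* M :+ c :* L) :* K) ≈-refl

  distrib-lem : ∀ a b c K L M → a * (b * M + c * L) * ((K * L) * (K * M)) ≈
    (a * b * (K * M) + a * c * (K * L)) * (K * (L * M))
  distrib-lem = solve 6 (λ a b c K L M → a :* (b :* M :+ c :* L) :* ((K :* L) :* (K :* M)) :=
    (a :* b :* (K :* M) :+ a :* c :* (K :* L)) :* (K :* (L :* M))) ≈-refl

------------------------------------------------------------------------
-- The localisation R[1/s] at a regular element s; a /s^ k stands for a/sᵏ

module Localisation {c ℓ} (R : CommutativeRing c ℓ) (s : CommutativeRing.Carrier R)
  (s-regular : ∀ {x y} → CommutativeRing._≈_ R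
                 (CommutativeRing._*_ R s x) (CommutativeRing._*_ R s y) →
                 CommutativeRing._≈_ R x y)
  where

  private
    module R = CommutativeRing R
    open R using (_≈_; _+_; _*_; -_; 0#; 1#)
    open import Algebra.Properties.Semiring.Exp R.semiring using (_^_; ^-homo-*)
    import Algebra.Properties.Ring R.ring as RP
    open import Relation.Binary.Reasoning.Setoid R.setoid
    open RingIdentities R

  infix 8 _/s^_

  record Fraction : Set c where
    constructor _/s^_
    field
      numerator : R.Carrier
      exponent  : ℕ

  open Fraction

  infix 4 _≈ᶠ_

  record _≈ᶠ_ (x y : Fraction) : Set ℓ where
    constructor mk-≈ᶠ
    field
      cross : numerator x * s ^ exponent y ≈ numerator y * s ^ exponent x

  _+ᶠ_ _*ᶠ_ : Fraction → Fraction → Fraction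
  (a /s^ k) +ᶠ (b /s^ l) = (a * s ^ l + b * s ^ k) /s^ (k ℕ.+ l)
  (a /s^ k) *ᶠ (b /s^ l) = (a * b) /s^ (k ℕ.+ l)

  -ᶠ_ : Fraction → Fraction
  -ᶠ (a /s^ k) = (- a) /s^ k

  embed : R.Carrier → Fraction
  embed a = a /s^ 0

  private
    s^-regular : ∀ k {x y} → x * s ^ k ≈ y * s ^ k → x ≈ y
    s^-regular zero    {x} {y} e = R.trans (R.sym (R.*-identityʳ x)) (R.trans e (R.*-identityʳ y))
    s^-regular (suc k) {x} {y} e = s^-regular k (s-regular
      (R.trans (left-swap x s (s ^ k)) (R.trans e (R.sym (left-swap y s (s ^ k))))))

    by-parts : ∀ {a b k l} → a ≈ b → k ≡ l → (a /s^ k) ≈ᶠ (b /s^ l)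
    by-parts e refl = mk-≈ᶠ (R.*-congʳ e)

    hom : ∀ k l → s ^ (k ℕ.+ l) ≈ s ^ k * s ^ l
    hom = ^-homo-* s

    ≈ᶠ-trans : ∀ {x y z} → x ≈ᶠ y → y ≈ᶠ z → x ≈ᶠ z
    ≈ᶠ-trans {a /s^ k} {b /s^ l} {c /s^ m} (mk-≈ᶠ p) (mk-≈ᶠ q) = mk-≈ᶠ (s^-regular l (begin
      a * s ^ m * s ^ l  ≈⟨ right-swap a (s ^ m) (s ^ l) ⟩
      a * s ^ l * s ^ m  ≈⟨ R.*-congʳ p ⟩
      b * s ^ k * s ^ m  ≈⟨ right-swap b (s ^ k) (s ^ m) ⟩
      b * s ^ m * s ^ k  ≈⟨ R.*-congʳ q ⟩
      c * s ^ l * s ^ k  ≈⟨ right-swap c (s ^ l) (s ^ k) ⟩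
      c * s ^ k * s ^ l  ∎))

    +ᶠ-cong : ∀ {x x′ y y′} → x ≈ᶠ x′ → y ≈ᶠ y′ → (x +ᶠ y) ≈ᶠ (x′ +ᶠ y′)
    +ᶠ-cong {a /s^ k} {a′ /s^ k′} {b /s^ l} {b′ /s^ l′} (mk-≈ᶠ p) (mk-≈ᶠ q) = mk-≈ᶠ (begin
      (a * s ^ l + b * s ^ k) * s ^ (k′ ℕ.+ l′)
        ≈⟨ R.*-congˡ (hom k′ l′) ⟩
      (a * s ^ l + b * s ^ k) * (s ^ k′ * s ^ l′)
        ≈⟨ +-cong-lem a b (s ^ k) (s ^ l) (s ^ k′) (s ^ l′) ⟩
      (a * s ^ k′) * (s ^ l * s ^ l′) + (b * s ^ l′) * (s ^ k * s ^ k′)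
        ≈⟨ R.+-cong (R.*-congʳ p) (R.*-congʳ q) ⟩
      (a′ * s ^ k) * (s ^ l * s ^ l′) + (b′ * s ^ l) * (s ^ k * s ^ k′)
        ≈⟨ +-cong-lem′ a′ b′ (s ^ k) (s ^ l) (s ^ k′) (s ^ l′) ⟩
      (a′ * s ^ l′ + b′ * s ^ k′) * (s ^ k * s ^ l)
        ≈⟨ R.*-congˡ (hom k l) ⟨
      (a′ * s ^ l′ + b′ * s ^ k′) * s ^ (k ℕ.+ l)  ∎)

    *ᶠ-cong : ∀ {x x′ y y′} → x ≈ᶠ x′ → y ≈ᶠ y′ → (x *ᶠ y) ≈ᶠ (x′ *ᶠ y′)
    *ᶠ-cong {a /s^ k} {a′ /s^ k′} {b /s^ l} {b′ /s^ l′} (mk-≈ᶠ p) (mk-≈ᶠ q) = mk-≈ᶠ (begin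
      a * b * s ^ (k′ ℕ.+ l′)      ≈⟨ R.*-congˡ (hom k′ l′) ⟩
      a * b * (s ^ k′ * s ^ l′)    ≈⟨ interchange a b (s ^ k′) (s ^ l′) ⟩
      (a * s ^ k′) * (b * s ^ l′)  ≈⟨ R.*-cong p q ⟩
      (a′ * s ^ k) * (b′ * s ^ l)  ≈⟨ interchange a′ b′ (s ^ k) (s ^ l) ⟨
      a′ * b′ * (s ^ k * s ^ l)    ≈⟨ R.*-congˡ (hom k l) ⟨
      a′ * b′ * s ^ (k ℕ.+ l)      ∎)

    -ᶠ-cong : ∀ {x y} → x ≈ᶠ y → (-ᶠ x) ≈ᶠ (-ᶠ y)
    -ᶠ-cong {a /s^ k} {b /s^ l} (mk-≈ᶠ p) = mk-≈ᶠ (begin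
      - a * s ^ l    ≈⟨ RP.-‿distribˡ-* a (s ^ l) ⟨
      - (a * s ^ l)  ≈⟨ R.-‿cong p ⟩
      - (b * s ^ k)  ≈⟨ RP.-‿distribˡ-* b (s ^ k) ⟩
      - b * s ^ k    ∎)

    +ᶠ-assoc : ∀ x y z → ((x +ᶠ y) +ᶠ z) ≈ᶠ (x +ᶠ (y +ᶠ z))
    +ᶠ-assoc (a /s^ k) (b /s^ l) (c /s^ m) = by-parts (begin
      (a * s ^ l + b * s ^ k) * s ^ m + c * s ^ (k ℕ.+ l)
        ≈⟨ R.+-congˡ (R.*-congˡ (hom k l)) ⟩
      (a * s ^ l + b * s ^ k) * s ^ m + c * (s ^ k * s ^ l)
        ≈⟨ +-assoc-lem a b c (s ^ k) (s ^ l) (s ^ m) ⟩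
      a * (s ^ l * s ^ m) + (b * s ^ m + c * s ^ l) * s ^ k
        ≈⟨ R.+-congʳ (R.*-congˡ (hom l m)) ⟨
      a * s ^ (l ℕ.+ m) + (b * s ^ m + c * s ^ l) * s ^ k  ∎)
      (ℕ.+-assoc k l m)

    +ᶠ-comm : ∀ x y → (x +ᶠ y) ≈ᶠ (y +ᶠ x)
    +ᶠ-comm (a /s^ k) (b /s^ l) = by-parts (R.+-comm _ _) (ℕ.+-comm k l)

    *ᶠ-comm : ∀ x y → (x *ᶠ y) ≈ᶠ (y *ᶠ x)
    *ᶠ-comm (a /s^ k) (b /s^ l) = by-parts (R.*-comm a b) (ℕ.+-comm k l)

    +ᶠ-identityˡ : ∀ x → (embed 0# +ᶠ x) ≈ᶠ x
    +ᶠ-identityˡ (a /s^ k) = by-parts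
      (R.trans (R.+-cong (R.zeroˡ _) (R.*-identityʳ a)) (R.+-identityˡ a)) refl

    -ᶠ-inverseˡ : ∀ x → ((-ᶠ x) +ᶠ x) ≈ᶠ embed 0#
    -ᶠ-inverseˡ (a /s^ k) = mk-≈ᶠ (begin
      (- a * s ^ k + a * s ^ k) * 1#  ≈⟨ R.*-identityʳ _ ⟩
      - a * s ^ k + a * s ^ k         ≈⟨ R.distribʳ (s ^ k) (- a) a ⟨
      (- a + a) * s ^ k               ≈⟨ R.*-congʳ (R.-‿inverseˡ a) ⟩
      0# * s ^ k                      ≈⟨ R.zeroˡ _ ⟩
      0#                              ≈⟨ R.zeroˡ _ ⟨
      0# * s ^ (k ℕ.+ k)              ∎)

    *ᶠ-distribˡ : ∀ x y z → (x *ᶠ (y +ᶠ z)) ≈ᶠ ((x *ᶠ y) +ᶠ (x *ᶠ z))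
    *ᶠ-distribˡ (a /s^ k) (b /s^ l) (c /s^ m) = mk-≈ᶠ (begin
      a * (b * s ^ m + c * s ^ l) * s ^ ((k ℕ.+ l) ℕ.+ (k ℕ.+ m))
        ≈⟨ R.*-congˡ (R.trans (hom (k ℕ.+ l) (k ℕ.+ m)) (R.*-cong (hom k l) (hom k m))) ⟩
      a * (b * s ^ m + c * s ^ l) * ((s ^ k * s ^ l) * (s ^ k * s ^ m))
        ≈⟨ distrib-lem a b c (s ^ k) (s ^ l) (s ^ m) ⟩
      (a * b * (s ^ k * s ^ m) + a * c * (s ^ k * s ^ l)) * (s ^ k * (s ^ l * s ^ m))
        ≈⟨ R.*-cong (R.+-cong (R.*-congˡ (hom k m)) (R.*-congˡ (hom k l)))
             (R.trans (hom k (l ℕ.+ m)) (R.*-congˡ (hom l m))) ⟨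
      (a * b * s ^ (k ℕ.+ m) + a * c * s ^ (k ℕ.+ l)) * s ^ (k ℕ.+ (l ℕ.+ m))  ∎)

    *ᶠ-identityˡ : ∀ x → (embed 1# *ᶠ x) ≈ᶠ x
    *ᶠ-identityˡ (a /s^ k) = by-parts (R.*-identityˡ a) refl

    setoid : Setoid c ℓ
    setoid = record
      { Carrier = Fraction
      ; _≈_ = _≈ᶠ_
      ; isEquivalence = record
        { refl = mk-≈ᶠ R.refl
        ; sym = λ { (mk-≈ᶠ e) → mk-≈ᶠ (R.sym e) }
        ; trans = ≈ᶠ-trans } }

    open import Algebra.Consequences.Setoid setoid
      using (comm∧idˡ⇒id; comm∧invˡ⇒inv; comm∧distrˡ⇒distr)

  commutativeRing : CommutativeRing c ℓ
  commutativeRing = record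
    { Carrier = Fraction ; _≈_ = _≈ᶠ_ ; _+_ = _+ᶠ_ ; _*_ = _*ᶠ_ ; -_ = -ᶠ_
    ; 0# = embed 0# ; 1# = embed 1#
    ; isCommutativeRing = record
      { isRing = record
        { +-isAbelianGroup = record
          { isGroup = record
            { isMonoid = record
              { isSemigroup = record
                { isMagma = record
                  { isEquivalence = Setoid.isEquivalence setoid
                  ; ∙-cong = +ᶠ-cong }
                ; assoc = +ᶠ-assoc }
              ; identity = comm∧idˡ⇒id +ᶠ-comm +ᶠ-identityˡ }
            ; inverse = comm∧invˡ⇒inv +ᶠ-comm -ᶠ-inverseˡ
            ; ⁻¹-cong = -ᶠ-cong }
          ; comm = +ᶠ-comm }
        ; *-cong = *ᶠ-cong
        ; *-assoc = λ { (a /s^ k) (b /s^ l) (c /s^ m) →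
                        by-parts (R.*-assoc a b c) (ℕ.+-assoc k l m) }
        ; *-identity = comm∧idˡ⇒id *ᶠ-comm *ᶠ-identityˡ
        ; distrib = comm∧distrˡ⇒distr +ᶠ-cong *ᶠ-comm *ᶠ-distribˡ }
      ; *-comm = *ᶠ-comm } }

------------------------------------------------------------------------

module Padic (p : ℕ) .{{_ : NonTrivial p}} where

  private instance
    p≢0 : NonZero p
    p≢0 = ℕ.nonTrivial⇒nonZero p

  -- Elements of the inverse limit of the ℤ/pᵏ are compatible families.
  record ℤₚ : Set where
    constructor mkℤₚ
    field
      proj       : ℕ → ℤ
      compatible : ∀ k → proj (suc k) ≡ proj k [mod p ℕ.^ k ]

  open ℤₚ public

  infix 4 _≈ₚ_

  record _≈ₚ_ (x y : ℤₚ) : Set where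
    constructor mk-≈ₚ
    field
      proj-≈ : ∀ k → proj x k ≡ proj y k [mod p ℕ.^ k ]

  open _≈ₚ_ public

  fromℤ : ℤ → ℤₚ
  fromℤ a = mkℤₚ (λ _ → a) (λ _ → mod-reflexive refl)

  ℤₚ-commutativeRing : CommutativeRing 0ℓ 0ℓ
  ℤₚ-commutativeRing = record
    { Carrier = ℤₚ
    ; _≈_ = _≈ₚ_
    ; _+_ = λ x y → mkℤₚ (λ k → proj x k ℤ.+ proj y k) (λ k → mod-+ (compatible x k) (compatible y k))
    ; _*_ = λ x y → mkℤₚ (λ k → proj x k ℤ.* proj y k) (λ k → mod-* (compatible x k) (compatible y k))
    ; -_ = λ x → mkℤₚ (λ k → ℤ.- proj x k) (λ k → mod-neg (compatible x k))
    ; 0# = fromℤ 0ℤ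
    ; 1# = fromℤ 1ℤ
    ; isCommutativeRing = record
      { isRing = record
        { +-isAbelianGroup = record
          { isGroup = record
            { isMonoid = record
              { isSemigroup = record
                { isMagma = record
                  { isEquivalence = record
                    { refl = pointwise (λ _ → refl)
                    ; sym = λ e → mk-≈ₚ (λ k → mod-sym (proj-≈ e k))
                    ; trans = λ d e → mk-≈ₚ (λ k → mod-trans (proj-≈ d k) (proj-≈ e k)) }
                  ; ∙-cong = λ d e → mk-≈ₚ (λ k → mod-+ (proj-≈ d k) (proj-≈ e k)) }
                ; assoc = λ x y z → pointwise (λ k → ℤ.+-assoc (proj x k) (proj y k) (proj z k)) }
              ; identity = (λ x → pointwise (λ k → ℤ.+-identityˡ (proj x k)))
                         , (λ x → pointwise (λ k → ℤ.+-identityʳ (proj x k))) }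
            ; inverse = (λ x → pointwise (λ k → ℤ.+-inverseˡ (proj x k)))
                      , (λ x → pointwise (λ k → ℤ.+-inverseʳ (proj x k)))
            ; ⁻¹-cong = λ e → mk-≈ₚ (λ k → mod-neg (proj-≈ e k)) }
          ; comm = λ x y → pointwise (λ k → ℤ.+-comm (proj x k) (proj y k)) }
        ; *-cong = λ d e → mk-≈ₚ (λ k → mod-* (proj-≈ d k) (proj-≈ e k))
        ; *-assoc = λ x y z → pointwise (λ k → ℤ.*-assoc (proj x k) (proj y k) (proj z k))
        ; *-identity = (λ x → pointwise (λ k → ℤ.*-identityˡ (proj x k)))
                     , (λ x → pointwise (λ k → ℤ.*-identityʳ (proj x k)))
        ; distrib = (λ x y z → pointwise (λ k → ℤ.*-distribˡ-+ (proj x k) (proj y k) (proj z k)))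
                  , (λ x y z → pointwise (λ k → ℤ.*-distribʳ-+ (proj x k) (proj y k) (proj z k))) }
      ; *-comm = λ x y → pointwise (λ k → ℤ.*-comm (proj x k) (proj y k)) } }
    where
    pointwise : ∀ {x y} → (∀ k → proj x k ≡ proj y k) → x ≈ₚ y
    pointwise e = mk-≈ₚ (λ k → mod-reflexive (e k))

  module Zₚ = CommutativeRing ℤₚ-commutativeRing

  fromℕ : ℕ → ℤₚ
  fromℕ n = fromℤ (+ n)

  fromℕ-p-regular : ∀ {x y} → fromℕ p Zₚ.* x Zₚ.≈ fromℕ p Zₚ.* y → x Zₚ.≈ y
  fromℕ-p-regular {x} {y} e = mk-≈ₚ λ k →
    mod-trans (mod-sym (compatible x k))
    (mod-trans (mod-cancel p (p ℕ.^ k) (proj-≈ e (suc k))) (compatible y k))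

  open import Algebra.Properties.Semiring.Divisibility Zₚ.semiring public
    using () renaming (_∣_ to _∣ₚ_)
  open import Algebra.Properties.Semiring.Exp Zₚ.semiring public
    using () renaming (_^_ to _^ₚ_)

  infix 4 _≡_[mod-p^_]

  _≡_[mod-p^_] : ℤₚ → ℤₚ → ℕ → Set
  m ≡ n [mod-p^ ℓ ] = fromℕ p ^ₚ ℓ ∣ₚ m Zₚ.- n

  infix 8 _+pℤₚ

  _+pℤₚ : ℕ → Pred ℤₚ 0ℓ
  (r +pℤₚ) x = ∃ λ c → x ≈ₚ fromℕ r Zₚ.+ fromℕ p Zₚ.* c

  -- The representative in {0,…,pᵏ-1} of the class of a modulo pᵏ.
  residue : ℤₚ → ℕ → ℕ
  residue a k = (proj a k ℤ.%ℕ (p ℕ.^ k)) {{ℕ.m^n≢0 p k}}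

  -- As a ≡ a₀ + a₁p + ⋯ + aᵢpⁱ modulo pⁱ⁺¹, the digit aᵢ is the leading one
  -- in the base-p expansion of that residue; see digit<p and digit-expansion.
  digit : ℤₚ → ℕ → ℕ
  digit a i = (residue a (suc i) ℕ./ (p ℕ.^ i)) {{ℕ.m^n≢0 p i}}

  infix 8 _%p

  _%p : ℤₚ → ℕ
  a %p = digit a 0

  digit<p : ∀ a i → digit a i ℕ.< p
  digit<p a i =
    ℕ.m<n*o⇒m/o<n {{ℕ.m^n≢0 p i}} (ℤ.n%ℕd<d (proj a (suc i)) (p ℕ.^ suc i) {{ℕ.m^n≢0 p (suc i)}})

  digitSum : ℤₚ → ℕ → ℕ
  digitSum a zero    = 0
  digitSum a (suc k) = digitSum a k ℕ.+ digit a k ℕ.* p ℕ.^ k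

  digit-expansion : ∀ a k → proj a k ≡ + digitSum a k [mod p ℕ.^ k ]
  digit-expansion a k =
    subst (λ n → proj a k ≡ + n [mod p ℕ.^ k ]) (residue≡digitSum k)
    (mod-%ℕ (proj a k) (p ℕ.^ k) {{ℕ.m^n≢0 p k}})
    where
    residue-suc : ∀ k → (residue a (suc k) ℕ.% (p ℕ.^ k)) {{ℕ.m^n≢0 p k}} ≡ residue a k
    residue-suc k = %-unique (p ℕ.^ k) {{ℕ.m^n≢0 p k}}
      (mod-trans (mod-sym (mod-weaken p (p ℕ.^ k)
        (mod-%ℕ (proj a (suc k)) (p ℕ.^ suc k) {{ℕ.m^n≢0 p (suc k)}})))
      (mod-trans (compatible a k) (mod-%ℕ (proj a k) (p ℕ.^ k) {{ℕ.m^n≢0 p k}})))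
      (ℤ.n%ℕd<d (proj a k) (p ℕ.^ k) {{ℕ.m^n≢0 p k}})

    residue≡digitSum : ∀ k → residue a k ≡ digitSum a k
    residue≡digitSum zero    = ℕ.n<1⇒n≡0 (ℤ.n%ℕd<d (proj a 0) 1)
    residue≡digitSum (suc k) =
      ≡.trans (ℕ.m≡m%n+[m/n]*n (residue a (suc k)) (p ℕ.^ k) {{ℕ.m^n≢0 p k}})
        (cong (ℕ._+ digit a k ℕ.* p ℕ.^ k) (≡.trans (residue-suc k) (residue≡digitSum k)))

  private
    module L = Localisation ℤₚ-commutativeRing (fromℕ p) fromℕ-p-regular

  open L public
    using (mk-≈ᶠ; module _≈ᶠ_)
    renaming ( Fraction to ℚₚ; module Fraction to ℚₚ; _/s^_ to _/p^_; embed to fromℤₚ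
             ; commutativeRing to ℚₚ-commutativeRing )

  module Qₚ = CommutativeRing ℚₚ-commutativeRing

  open import Algebra.Properties.Semiring.Exp Qₚ.semiring public
    using () renaming (_^_ to _^ᵠ_)
  open import Algebra.Properties.Semiring.Sum Qₚ.semiring public
    using (sum)

  Integral : Pred ℚₚ 0ℓ
  Integral x = ∃ λ z → x Qₚ.≈ fromℤₚ z

  -- The valuation cannot be computed (that would decide x ≈ 0), so it is given
  -- by its graph; ⊤⁺ stands for ∞.
  data ν_≔_ (x : ℚₚ) : ℤ ⁺ → Set where
    ν-integral : ∀ {k} → x ∈ Integral → ¬ x Qₚ.≈ Qₚ.0# →
                 IsGreatest ℕ._≤_ (λ k → x Qₚ.* (Zₚ.1# /p^ k) ∈ Integral) k →
                 ν x ≔ [ + k ]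
    ν-fraction : ∀ {k} → x ∉ Integral →
                 IsLeast ℕ._≤_ (λ k → 1 ℕ.≤ k × x Qₚ.* fromℤₚ (fromℕ p ^ₚ k) ∈ Integral) k →
                 ν x ≔ [ ℤ.- + k ]
    ν-zero     : x Qₚ.≈ Qₚ.0# → ν x ≔ ⊤⁺

  -- a 0 , … , a d are the coefficients of a polynomial of formal degree d.
  eval : ∀ {d} → Vector ℚₚ (suc d) → ℚₚ → ℚₚ
  eval a x = sum (λ i → a i Qₚ.* x ^ᵠ toℕ i)

  valuations : ∀ {d} → Vector ℚₚ (suc d) → Pred (ℤ ⁺) 0ℓ
  valuations a v = ∃ λ i → ν a i ≔ v

  -- K = - min ({ν(aᵢ) ∣ 0 ≤ i ≤ d} ∪ {0})
  IsDenominatorExponent : ∀ {d} → Vector ℚₚ (suc d) → ℕ → Set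
  IsDenominatorExponent a K = IsLeast _≤⁺_ (valuations a ∪ ｛ [ 0ℤ ] ｝) [ ℤ.- + K ]

  -- Functions between the underlying sets: for the representatives used here
  -- this means maps respecting _≈ₚ_.
  Map : Set
  Map = Zₚ.setoid ⟶ₛ Zₚ.setoid

  tilde : Map → ℤₚ → ℤₚ
  tilde f n = (f ⟨$⟩ n) Zₚ.- fromℕ ((f ⟨$⟩ n) %p)

  PreservesOn : Pred ℤₚ 0ℓ → Map → ℕ → Set
  PreservesOn S f ℓ = ∀ m n → m ∈ S → n ∈ S →
    m ≡ n [mod-p^ ℓ ] → tilde f m ≡ tilde f n [mod-p^ ℓ ]

  PreservesAndReflectsOn : Pred ℤₚ 0ℓ → Map → ℕ → Set
  PreservesAndReflectsOn S f ℓ = ∀ m n → m ∈ S → n ∈ S →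
    m ≡ n [mod-p^ ℓ ] ⇔ tilde f m ≡ tilde f n [mod-p^ ℓ ]

  WeaklySuitableAt : ℕ → Map → Pred ℕ 0ℓ → Set
  WeaklySuitableAt r f L = ∀ ℓ → ℓ ∈ L → PreservesOn (r +pℤₚ) f ℓ

  SuitableAt : ℕ → Map → Pred ℕ 0ℓ → Set
  SuitableAt r f L = ∀ ℓ → ℓ ∈ L → PreservesAndReflectsOn (r +pℤₚ) f ℓ

  WeaklySuitable : ℕ → Map → Set
  WeaklySuitable r f = WeaklySuitableAt r f U

  Suitable : ℕ → Map → Set
  Suitable r f = SuitableAt r f U

  W : ℕ → ℕ → Pred ℤₚ 0ℓ
  W r ℓ = (λ x → ∃ λ n → n ℕ.< p ℕ.^ ℓ × x ≈ₚ fromℕ n) ∩ r +pℤₚ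

{-# OPTIONS --safe #-}
module Submission where

open import Defs
open import Level using (_⊔_)
open import Algebra.Bundles using (CommutativeRing)
open import Data.Fin.Base as Fin using (Fin; toℕ)
open import Data.Integer.Base as ℤ using (ℤ; +_; 0ℤ)
import Data.Integer.DivMod as ℤ
import Data.Integer.Divisibility.Signed as ℤ∣
open ℤ∣ using (divides)
import Data.Integer.Properties as ℤ
import Data.Integer.Tactic.RingSolver as ℤ-Solver
open import Data.Nat.Base as ℕ using (ℕ; zero; suc; NonTrivial; NonZero)
import Data.Nat.DivMod as ℕ
import Data.Nat.Properties as ℕ
open import Data.Product.Base using (∃; _×_; _,_; proj₁; proj₂)
open import Data.Sum.Base using (inj₁; inj₂; [_,_]′)
open import Data.Vec.Functional using (Vector)
open import Function.Base using (_∘_)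
open import Function.Bundles using (_⇔_; _⟨$⟩_; mk⇔; Equivalence)
open import Relation.Binary.Construct.Add.Supremum.NonStrict ℤ._≤_ using ([≤]-injective)
open import Relation.Binary.PropositionalEquality.Core as ≡ using (_≡_; refl; cong; cong₂; subst; subst₂)
open import Relation.Nullary.Construct.Add.Supremum using ([_])
open import Relation.Nullary.Decidable.Core as Dec using (Dec; yes; no; map′; _×-dec_)
open import Relation.Nullary.Negation.Core using (¬_; contradiction)
open import Relation.Unary using (Pred; Decidable; _∈_; _∪_; ｛_｝)

-- Write s for p, P = s^K, and F = P·g, a polynomial over ℤₚ which has an expansion
-- F(n + v) = F(n) + h v + q v² at every n, where h = F′(n). Since P f = F on r + pℤₚ,
-- m ≡ n (mod s^(K+k)) implies f(m) ≡ f(n) (mod s^k), which gives the witness sets.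
-- For v = s^ℓ u with ℓ > K, comparing both expansions shows that f is weakly suitable at ℓ
-- if and only if P ∣ h for all n in r + pℤₚ, a condition independent of ℓ. In this case
-- h = P c and f(n + s^ℓ u) ≡ f(n) + s^ℓ c u (mod s^(2ℓ-K)), so that for ℓ ≥ K + 2
-- reflecting congruences at level ℓ + 1 implies reflecting them at level ℓ + 2.

-- Polynomial identities behind the expansions of F.

private module RingIdentities {c ℓ} (R : CommutativeRing c ℓ) where
  open CommutativeRing R using (_≈_; _+_; _*_; commutativeSemiring) renaming (refl to ≈-refl)
  open import Algebra.Solver.Ring.NaturalCoefficients.Default commutativeSemiring

  -- Here and below `P` is s^K, `Y` is f(n) and `S` is a further power of s. In this identity
  -- nothing is known about the slope `h`, so one factor `P` is lost.
  expand-coarse : ∀ P Y h q S u → P * Y + h * (P * S * u) + q * (P * S * u * (P * S * u)) ≈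
    P * (Y + S * (h * u + q * u * (P * S * u)))
  expand-coarse = solve 6 (λ P Y h q S u →
    P :* Y :+ h :* (P :* S :* u) :+ q :* (P :* S :* u :* (P :* S :* u)) :=
    P :* (Y :+ S :* (h :* u :+ q :* u :* (P :* S :* u)))) ≈-refl

  -- With `h` replaced by `c * P` the factor `P` is kept, and the quadratic term gains an extra `S`
  -- over the linear one.
  expand-fine : ∀ P Y c q S u →
    P * Y + c * P * (P * S * u) + q * (P * S * u * (P * S * u)) ≈
    P * (Y + P * S * (c * u + S * (q * u * u)))
  expand-fine = solve 6 (λ P Y c q S u →
    P :* Y :+ c :* P :* (P :* S :* u) :+ q :* (P :* S :* u :* (P :* S :* u)) :=
    P :* (Y :+ P :* S :* (c :* u :+ S :* (q :* u :* u)))) ≈-refl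

  expand-slopeˡ : ∀ P Y T t → P * (Y + T * t) ≈ P * Y + T * (t * P)
  expand-slopeˡ = solve 4 (λ P Y T t →
    P :* (Y :+ T :* t) := P :* Y :+ T :* (t :* P)) ≈-refl

  expand-slopeʳ : ∀ P Y h q S → P * Y + h * (P * S) + q * (P * S * (P * S)) ≈
    P * Y + P * S * (h + q * S * P)
  expand-slopeʳ = solve 5 (λ P Y h q S →
    P :* Y :+ h :* (P :* S) :+ q :* (P :* S :* (P :* S)) :=
    P :* Y :+ P :* S :* (h :+ q :* S :* P)) ≈-refl

  sum-expansion : ∀ F G v g h q r → (F + g * v + q * (v * v)) + (G + h * v + r * (v * v)) ≈
    (F + G) + (g + h) * v + (q + r) * (v * v)
  sum-expansion = solve 7 (λ F G v g h q r →
    (F :+ g :* v :+ q :* (v :* v)) :+ (G :+ h :* v :+ r :* (v :* v)) :=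
    (F :+ G) :+ (g :+ h) :* v :+ (q :+ r) :* (v :* v)) ≈-refl

  product-expansion : ∀ F G v g h q r → (F + g * v + q * (v * v)) * (G + h * v + r * (v * v)) ≈
    (F * G) + (F * h + G * g) * v +
    (F * r + g * h + q * G + (g * r + q * h) * v + q * r * (v * v)) * (v * v)
  product-expansion = solve 7 (λ F G v g h q r →
    (F :+ g :* v :+ q :* (v :* v)) :* (G :+ h :* v :+ r :* (v :* v)) :=
    (F :* G) :+ (F :* h :+ G :* g) :* v :+
    (F :* r :+ g :* h :+ q :* G :+ (g :* r :+ q :* h) :* v :+ q :* r :* (v :* v)) :* (v :* v)) ≈-refl

-- Congruences modulo an element of a commutative ring.

module Congruences {c ℓ} (R : CommutativeRing c ℓ) where
  open CommutativeRing R
  open import Algebra.Properties.Semiring.Divisibility semiring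
    using (_∣_; _,_; ∣ʳ-respʳ-≈; _∣0)
  open import Algebra.Properties.AbelianGroup +-abelianGroup
    using (⁻¹-anti-homo‿-; xyx⁻¹≈y; //-rightDividesˡ; ⁻¹-∙-comm)
  open import Algebra.Properties.Ring ring using (-‿distribˡ-*)
  open import Algebra.Properties.CommutativeSemigroup +-commutativeSemigroup using (interchange)
  open import Relation.Binary.Reasoning.Setoid setoid

  telescope : ∀ x y z → (x - y) + (y - z) ≈ x - z
  telescope x y z = begin
    (x - y) + (y - z)  ≈⟨ +-assoc (x - y) y (- z) ⟨
    (x - y) + y - z    ≈⟨ +-congʳ (//-rightDividesˡ y x) ⟩
    x - z              ∎

  ∣-+ : ∀ {d x y} → d ∣ x → d ∣ y → d ∣ x + y
  ∣-+ {d} (a , e) (b , e′) = a + b , trans (distribʳ d a b) (+-cong e e′)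

  ∣-neg : ∀ {d x} → d ∣ x → d ∣ - x
  ∣-neg {d} (a , e) = - a , trans (sym (-‿distribˡ-* a d)) (-‿cong e)

  ≈⇒∣- : ∀ {d x y} → x ≈ y → d ∣ x - y
  ≈⇒∣- {d} {x} {y} e = ∣ʳ-respʳ-≈ (sym (trans (+-congʳ e) (-‿inverseʳ y))) (d ∣0)

  ∣-sym : ∀ {d x y} → d ∣ x - y → d ∣ y - x
  ∣-sym {d} {x} {y} e = ∣ʳ-respʳ-≈ (⁻¹-anti-homo‿- x y) (∣-neg e)

  ∣-trans : ∀ {d x y z} → d ∣ x - y → d ∣ y - z → d ∣ x - z
  ∣-trans {d} {x} {y} {z} e e′ = ∣ʳ-respʳ-≈ (telescope x y z) (∣-+ e e′)

  ∣-cong-+ : ∀ {d x y x′ y′} → d ∣ x - y → d ∣ x′ - y′ → d ∣ (x + x′) - (y + y′)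
  ∣-cong-+ {d} {x} {y} {x′} {y′} e e′ = ∣ʳ-respʳ-≈
    (trans (interchange x (- y) x′ (- y′)) (+-congˡ (⁻¹-∙-comm y y′))) (∣-+ e e′)

  ≈+⇒∣- : ∀ {d x y} u → x ≈ y + d * u → d ∣ x - y
  ≈+⇒∣- {d} {x} {y} u e = u ,
    trans (*-comm u d) (sym (trans (+-congʳ e) (xyx⁻¹≈y y (d * u))))

  ∣-⇒≈+ : ∀ {d x y} → d ∣ x - y → ∃ λ u → x ≈ y + d * u
  ∣-⇒≈+ {d} {x} {y} (u , e) = u , (begin
    x            ≈⟨ //-rightDividesˡ y x ⟨
    (x - y) + y  ≈⟨ +-comm (x - y) y ⟩
    y + (x - y)  ≈⟨ +-congˡ (trans (*-comm d u) e) ⟨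
    y + d * u    ∎)

  ∣-of-sum : ∀ {d x y z} → d ∣ x → d ∣ y → x ≈ z + y → d ∣ z
  ∣-of-sum {d} {x} {y} {z} d∣x d∣y e = ∣ʳ-respʳ-≈
    (trans (+-congʳ (trans e (+-comm z y))) (xyx⁻¹≈y y z)) (∣-+ d∣x (∣-neg d∣y))

-- Second-order expansions of polynomial functions.

module Expansion {c ℓ} (R : CommutativeRing c ℓ) where
  open CommutativeRing R
  open import Algebra.Properties.Semiring.Exp semiring using (_^_)
  open import Relation.Binary.Reasoning.Setoid setoid
  open RingIdentities R

  -- The slope `h` is chosen before `v`, so it depends on `n` alone and acts as the derivative
  -- there; only `q` may vary with `v`. Quantifying over `m ≈ n + v` builds in that F respects
  -- equality.
  Expandable : (Carrier → Carrier) → Set _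
  Expandable F = ∀ n → ∃ λ h → ∀ {m} v → m ≈ n + v →
    ∃ λ q → F m ≈ F n + h * v + q * (v * v)

  expandable-const : ∀ a → Expandable (λ _ → a)
  expandable-const a n = 0# , λ v _ → 0# , sym (begin
    a + 0# * v + 0# * (v * v)  ≈⟨ +-cong (+-congˡ (zeroˡ v)) (zeroˡ _) ⟩
    a + 0# + 0#                ≈⟨ trans (+-identityʳ _) (+-identityʳ a) ⟩
    a                          ∎)

  expandable-id : Expandable (λ x → x)
  expandable-id n = 1# , λ v e → 0# , trans e (sym (begin
    n + 1# * v + 0# * (v * v)  ≈⟨ +-cong (+-congˡ (*-identityˡ v)) (zeroˡ _) ⟩
    n + v + 0#                 ≈⟨ +-identityʳ _ ⟩
    n + v                      ∎))

  expandable-+ : ∀ {F G} → Expandable F → Expandable G → Expandable (λ x → F x + G x)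
  expandable-+ F G n with F n | G n
  ... | g , F′ | h , G′ = g + h , λ v e → let q , e₁ = F′ v e ; r , e₂ = G′ v e in
    q + r , trans (+-cong e₁ e₂) (sum-expansion _ _ v g h q r)

  expandable-* : ∀ {F G} → Expandable F → Expandable G → Expandable (λ x → F x * G x)
  expandable-* F G n with F n | G n
  ... | g , F′ | h , G′ = _ , λ v e → let q , e₁ = F′ v e ; r , e₂ = G′ v e in
    _ , trans (*-cong e₁ e₂) (product-expansion _ _ v g h q r)

  expandable-^ : ∀ {F} → Expandable F → ∀ i → Expandable (λ x → F x ^ i)
  expandable-^ F zero    = expandable-const 1#
  expandable-^ F (suc i) = expandable-* F (expandable-^ F i)

-- Polynomials over R[1/s] and clearing their denominators.

module Divided {c ℓ} (R : CommutativeRing c ℓ) (s : CommutativeRing.Carrier R)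
  (s-regular : ∀ {x y} → CommutativeRing._≈_ R
                 (CommutativeRing._*_ R s x) (CommutativeRing._*_ R s y) →
                 CommutativeRing._≈_ R x y)
  where
  open CommutativeRing R hiding (zero) renaming (refl to ≈-refl)
  open import Algebra.Properties.Semiring.Divisibility semiring
    using (_∣_; _,_; ∣ʳ-respʳ-≈; ∣ʳ-trans; x∣ʳyx; ε∣ʳ_)
  open import Algebra.Properties.Semiring.Exp semiring public using (_^_)
  open import Algebra.Properties.Semiring.Exp semiring using (^-homo-*)
  open import Algebra.Properties.AbelianGroup +-abelianGroup using (∙-cancelˡ; //-rightDividesˡ)
  open RingIdentities R
  open Congruences R
  open Expansion R

  open Localisation R s s-regular public renaming (commutativeRing to Q-ring)
  module Q = CommutativeRing Q-ring
  open import Algebra.Properties.Semiring.Exp Q.semiring using (^-congˡ) renaming (_^_ to _^ᵠ_)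
  open import Algebra.Properties.Semiring.Sum Q.semiring using (sum; sum-cong-≋)
  open import Algebra.Properties.CommutativeSemigroup Q.*-commutativeSemigroup using (xy∙z≈xz∙y)
  import Relation.Binary.Reasoning.Setoid Q.setoid as Q-Reasoning

  eval : ∀ {d} → Vector Fraction d → Fraction → Fraction
  eval a x = sum (λ i → a i Q.* x ^ᵠ toℕ i)

  -- Value, ScaledIntegral, PreservesOn, … are records so that their instances over ℤₚ are
  -- compared by parameters: unfolding them would make the conversion checker compare
  -- compatibility proofs of p-adic integers, which does not terminate in practice.
  record Value {d} (a : Vector Fraction d) (x y : Carrier) : Set ℓ where
    constructor mk-value
    field
      embed≈eval : embed y Q.≈ eval a (embed x)

  value : ∀ {d} (a : Vector Fraction d) {x y x′ y′} →
    y′ Q.≈ embed y → x′ Q.≈ embed x → y′ Q.≈ eval a x′ → Value a x y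
  value a {x} {x′ = x′} y′≈ x′≈ e = mk-value (Q.trans (Q.sym y′≈) (Q.trans e
    (sum-cong-≋ {x = λ i → a i Q.* x′ ^ᵠ toℕ i} {λ i → a i Q.* embed x ^ᵠ toℕ i}
      (λ i → Q.*-congˡ {a i} (^-congˡ (toℕ i) x′≈)))))

  embed-cong : ∀ {x y} → x ≈ y → embed x Q.≈ embed y
  embed-cong e = mk-≈ᶠ (*-congʳ e)

  embed-injective : ∀ {x y} → embed x Q.≈ embed y → x ≈ y
  embed-injective (mk-≈ᶠ e) = trans (sym (*-identityʳ _)) (trans e (*-identityʳ _))

  embed-+ : ∀ x y → embed x Q.+ embed y Q.≈ embed (x + y)
  embed-+ x y = embed-cong (+-cong (*-identityʳ x) (*-identityʳ y))

  embed-^ : ∀ x i → embed x ^ᵠ i Q.≈ embed (x ^ i)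
  embed-^ x zero    = Q.refl
  embed-^ x (suc i) = Q.*-congˡ (embed-^ x i)

  Integral : Fraction → Set _
  Integral x = ∃ λ z → x Q.≈ embed z

  scaled : Fraction → ℕ → Fraction
  scaled x k = x Q.* embed (s ^ k)

  record ScaledIntegral (x : Fraction) (k : ℕ) : Set (c ⊔ ℓ) where
    constructor mk-scaled
    field
      integral : Integral (scaled x k)

  integral-scale : ∀ x {j k} → j ℕ.≤ k → ScaledIntegral x j → ScaledIntegral x k
  integral-scale x {j} {k} j≤k (mk-scaled (w , e)) = mk-scaled (w * s ^ (k ℕ.∸ j) , (begin
    x Q.* embed (s ^ k)                              ≈⟨ Q.*-congˡ (embed-cong s^k≈) ⟩
    x Q.* (embed (s ^ j) Q.* embed (s ^ (k ℕ.∸ j)))  ≈⟨ Q.*-assoc x _ _ ⟨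
    x Q.* embed (s ^ j) Q.* embed (s ^ (k ℕ.∸ j))    ≈⟨ Q.*-congʳ e ⟩
    embed (w * s ^ (k ℕ.∸ j))                        ∎))
    where
    open Q-Reasoning
    s^k≈ : s ^ k ≈ s ^ j * s ^ (k ℕ.∸ j)
    s^k≈ = trans (reflexive (cong (s ^_) (≡.sym (ℕ.m+[n∸m]≡n j≤k)))) (^-homo-* s j (k ℕ.∸ j))

  integral⇒scaled : ∀ x k → Integral x → ScaledIntegral x k
  integral⇒scaled x k (w , e) =
    integral-scale x {0} {k} ℕ.z≤n (mk-scaled (w , Q.trans (Q.*-identityʳ x) e))

  exponent-clears : ∀ x → ScaledIntegral x (Fraction.exponent x)
  exponent-clears (z /s^ e) = mk-scaled (z , mk-≈ᶠ (trans (*-identityʳ _)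
    (*-congˡ (reflexive (cong (s ^_) (≡.sym (ℕ.+-identityʳ e)))))))

  -- `F` is t·φ as a map into `R`. Bundling it with its expansion lets both be built up term by term
  -- along the polynomial.
  Clears : Carrier → (Carrier → Fraction) → Set _
  Clears t φ = ∃ λ F → Expandable F × (∀ x → φ x Q.* embed t Q.≈ embed (F x))

  clears-monomial : ∀ {t b} a i → a Q.* embed t Q.≈ embed b →
    Clears t (λ x → a Q.* embed x ^ᵠ i)
  clears-monomial {t} {b} a i e =
    (λ x → b * x ^ i) ,
    expandable-* (expandable-const b) (expandable-^ expandable-id i) , λ x → begin
      a Q.* embed x ^ᵠ i Q.* embed t  ≈⟨ xy∙z≈xz∙y a _ _ ⟩
      a Q.* embed t Q.* embed x ^ᵠ i  ≈⟨ Q.*-cong e (embed-^ x i) ⟩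
      embed (b * x ^ i)               ∎
    where open Q-Reasoning

  clears-sum : ∀ {t n} (φ : Fin n → Carrier → Fraction) → (∀ i → Clears t (φ i)) →
    Clears t (λ x → sum (λ i → φ i x))
  clears-sum {t} {zero}  φ c = (λ _ → 0#) , expandable-const 0# , λ x → Q.zeroˡ (embed t)
  clears-sum {t} {suc n} φ c =
    let F , F-exp , F≈ = c Fin.zero
        G , G-exp , G≈ = clears-sum (φ ∘ Fin.suc) (c ∘ Fin.suc)
    in (λ x → F x + G x) , expandable-+ F-exp G-exp , λ x → begin
      (φ Fin.zero x Q.+ sum (λ i → φ (Fin.suc i) x)) Q.* embed t
        ≈⟨ Q.distribʳ (embed t) (φ Fin.zero x) _ ⟩
      φ Fin.zero x Q.* embed t Q.+ sum (λ i → φ (Fin.suc i) x) Q.* embed t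
        ≈⟨ Q.+-cong (F≈ x) (G≈ x) ⟩
      embed (F x) Q.+ embed (G x)  ≈⟨ embed-+ (F x) (G x) ⟩
      embed (F x + G x)            ∎
    where open Q-Reasoning

  ClearsEval : ∀ {d} → Vector Fraction d → ℕ → Set _
  ClearsEval a k = Clears (s ^ k) (λ x → eval a (embed x))

  clears-eval : ∀ {d} (a : Vector Fraction d) k → (∀ i → ScaledIntegral (a i) k) → ClearsEval a k
  clears-eval a k b = clears-sum _ λ i →
    clears-monomial (a i) (toℕ i) (proj₂ (ScaledIntegral.integral (b i)))

  cleared-value : ∀ {d} (a : Vector Fraction d) k {x y} (c : ClearsEval a k) →
    Value a x y → proj₁ c x ≈ s ^ k * y
  cleared-value a k {x} {y} (F , _ , F≈) (mk-value e) = sym (embed-injective (begin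
    embed (s ^ k * y)                    ≈⟨ Q.*-comm (embed (s ^ k)) (embed y) ⟩
    embed y Q.* embed (s ^ k)            ≈⟨ Q.*-congʳ e ⟩
    eval a (embed x) Q.* embed (s ^ k)   ≈⟨ F≈ x ⟩
    embed (F x)                          ∎))
    where open Q-Reasoning

  -- Congruences modulo powers of `s` and the abstract setting.

  open import Relation.Binary.Reasoning.Setoid setoid

  ^-regular : ∀ k {x y} → s ^ k * x ≈ s ^ k * y → x ≈ y
  ^-regular zero    {x} {y} e = trans (sym (*-identityˡ x)) (trans e (*-identityˡ y))
  ^-regular (suc k) {x} {y} e = ^-regular k (s-regular
    (trans (sym (*-assoc s (s ^ k) x)) (trans e (*-assoc s (s ^ k) y))))

  infix 4 _≡_[s^_]

  _≡_[s^_] : Carrier → Carrier → ℕ → Set _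
  x ≡ y [s^ k ] = s ^ k ∣ x - y

  ^-∣ : ∀ {k l} → k ℕ.≤ l → s ^ k ∣ s ^ l
  ^-∣ {k} {l} k≤l = s ^ (l ℕ.∸ k) , (begin
    s ^ (l ℕ.∸ k) * s ^ k  ≈⟨ ^-homo-* s (l ℕ.∸ k) k ⟨
    s ^ (l ℕ.∸ k ℕ.+ k)    ≡⟨ cong (s ^_) (ℕ.m∸n+n≡m k≤l) ⟩
    s ^ l                  ∎)

  weaken : ∀ {k l x y} → k ℕ.≤ l → x ≡ y [s^ l ] → x ≡ y [s^ k ]
  weaken k≤l = ∣ʳ-trans (^-∣ k≤l)

  tilde : (f δ : Carrier → Carrier) → Carrier → Carrier
  tilde f δ n = f n - δ (f n)

  record PreservesOn (f δ : Carrier → Carrier) {ℓ′} (T : Pred Carrier ℓ′) (k : ℕ) :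
    Set (c ⊔ ℓ ⊔ ℓ′) where
    constructor mk-preserves
    field
      preserves : ∀ m n → m ∈ T → n ∈ T → m ≡ n [s^ k ] → tilde f δ m ≡ tilde f δ n [s^ k ]

  record PreservesAndReflectsOn (f δ : Carrier → Carrier) {ℓ′} (T : Pred Carrier ℓ′) (k : ℕ) :
    Set (c ⊔ ℓ ⊔ ℓ′) where
    constructor mk-preserves-reflects
    field
      equivalence : ∀ m n → m ∈ T → n ∈ T → m ≡ n [s^ k ] ⇔ tilde f δ m ≡ tilde f δ n [s^ k ]

  -- An axiomatic form of the p-adic situation: `S` stands for r + pℤₚ, `W` for the finite witness
  -- sets and `δ` for the zeroth digit. The bounds `1 ≤ k` and `1 ≤ N` matter because a congruence
  -- modulo s^0 does not remember the class of r.
  record Setting {ℓ′ ℓ″} (S : Pred Carrier ℓ′) (W : ℕ → Pred Carrier ℓ″)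
    (f δ : Carrier → Carrier) {d} (a : Vector Fraction d) (K : ℕ) : Set (c ⊔ ℓ ⊔ ℓ′ ⊔ ℓ″) where
    field
      S-shift        : ∀ {n} k u → 1 ℕ.≤ k → n ∈ S → n + s ^ k * u ∈ S
      a-scaled       : ∀ i → ScaledIntegral (a i) K
      f-value        : ∀ {n} → n ∈ S → Value a n (f n)
      δ-cong         : ∀ {x y} → x ≡ y [s^ 1 ] → δ x ≈ δ y
      W⊆S            : ∀ N {x} → x ∈ W N → x ∈ S
      representative : ∀ N {x} → 1 ℕ.≤ N → x ∈ S → ∃ λ x′ → x′ ∈ W N × x ≡ x′ [s^ N ]

  -- Witness sets and passage between levels in the abstract setting.

  module Suitability {ℓ′ ℓ″} {S : Pred Carrier ℓ′} {W : ℕ → Pred Carrier ℓ″}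
    {f δ : Carrier → Carrier} {d} {a : Vector Fraction d} {K : ℕ} (setting : Setting S W f δ a K)
    where
    open Setting setting

    private
      cleared : ClearsEval a K
      cleared = clears-eval a K a-scaled

      F : Carrier → Carrier
      F = proj₁ cleared

      F≈ : ∀ {n} → n ∈ S → F n ≈ s ^ K * f n
      F≈ {n} n∈ = cleared-value a K cleared (f-value n∈)

      P : Carrier
      P = s ^ K

      factored : ∀ j {m n u} → m ≈ n + s ^ (K ℕ.+ j) * u → m ≈ n + P * s ^ j * u
      factored j e = trans e (+-congˡ (*-congʳ (^-homo-* s K j)))

    Slope : Carrier → Carrier → Set _
    Slope n h = ∀ {m} v → m ∈ S → m ≈ n + v → ∃ λ q → P * f m ≈ P * f n + h * v + q * (v * v)

    slope : ∀ {n} → n ∈ S → ∃ (Slope n)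
    slope {n} n∈ = let h , E = proj₁ (proj₂ cleared) n in h , λ v m∈ e → let q , e′ = E v e in
      q , trans (sym (F≈ m∈)) (trans e′ (+-congʳ (+-congʳ (F≈ n∈))))

    -- Every term of the expansion beyond P f(n) is divisible by P s^k, and one factor P cancels
    -- from both sides.
    coarse : ∀ k {m n} → m ∈ S → n ∈ S → m ≡ n [s^ K ℕ.+ k ] → f m ≡ f n [s^ k ]
    coarse k {m} {n} m∈ n∈ m≡n =
      let u , e = ∣-⇒≈+ m≡n
          h , E = slope n∈
          q , e′ = E (P * s ^ k * u) m∈ (factored k e)
      in ≈+⇒∣- _ (^-regular K (trans e′ (expand-coarse P (f n) h q (s ^ k) u)))

    Preserves Reflects : ℕ → Set _
    Preserves ℓ = ∀ {m n} → m ∈ S → n ∈ S → m ≡ n [s^ ℓ ] → f m ≡ f n [s^ ℓ ]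
    Reflects  ℓ = ∀ {m n} → m ∈ S → n ∈ S → f m ≡ f n [s^ ℓ ] → m ≡ n [s^ ℓ ]

    -- Take the smallest step, T = s^(K+1+j). The expansion of F and the congruence for f give two
    -- expressions for P f(n + T); cancelling P f(n) and T leaves t P = h + q s^(1+j) P, where P
    -- divides all terms but h.
    slope-divisible : ∀ j → Preserves (K ℕ.+ suc j) → ∀ {n h} → n ∈ S → Slope n h → P ∣ h
    slope-divisible j pres {n} {h} n∈ E =
      ∣-of-sum (x∣ʳyx P t) (x∣ʳyx P (q * s ^ suc j)) tP≈
      where
      T = P * s ^ suc j
      m = n + s ^ (K ℕ.+ suc j) * 1#

      m∈ : m ∈ S
      m∈ = S-shift (K ℕ.+ suc j) 1# (ℕ.≤-trans (ℕ.s≤s ℕ.z≤n) (ℕ.m≤n+m (suc j) K)) n∈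

      fm≡ : ∃ λ t → f m ≈ f n + s ^ (K ℕ.+ suc j) * t
      fm≡ = ∣-⇒≈+ (pres m∈ n∈ (≈+⇒∣- 1# ≈-refl))

      t = proj₁ fm≡

      Pfm≡ : ∃ λ q → P * f m ≈ P * f n + h * T + q * (T * T)
      Pfm≡ = E T m∈
        (+-congˡ (trans (*-identityʳ _) (^-homo-* s K (suc j))))

      q = proj₁ Pfm≡

      tP≈ : t * P ≈ h + q * s ^ suc j * P
      tP≈ = ^-regular (K ℕ.+ suc j) (∙-cancelˡ (P * f n) _ _ (begin
        P * f n + s ^ (K ℕ.+ suc j) * (t * P)    ≈⟨ expand-slopeˡ P (f n) _ t ⟨
        P * (f n + s ^ (K ℕ.+ suc j) * t)        ≈⟨ *-congˡ (proj₂ fm≡) ⟨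
        P * f m                                  ≈⟨ proj₂ Pfm≡ ⟩
        P * f n + h * T + q * (T * T)            ≈⟨ expand-slopeʳ P (f n) h q (s ^ suc j) ⟩
        P * f n + T * (h + q * s ^ suc j * P)    ≈⟨ +-congˡ (*-congʳ (^-homo-* s K (suc j))) ⟨
        P * f n + s ^ (K ℕ.+ suc j) * (h + q * s ^ suc j * P)  ∎))

    -- `c` plays the role of h/P. At level ℓ = K + j the error has the factor s^(K+2j) = s^(2ℓ-K).
    LinearTo : ℕ → Carrier → Carrier → Set _
    LinearTo j n c = ∀ {m} u → m ∈ S → m ≈ n + s ^ (K ℕ.+ j) * u →
      ∃ λ w → f m ≈ f n + s ^ (K ℕ.+ j) * (c * u + s ^ j * w)

    slope⇒linear : ∀ {n h c} → c * P ≈ h → Slope n h → ∀ i → LinearTo i n c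
    slope⇒linear {n} {h} {c} cP≈h E i {m} u m∈ e =
      let q , e′ = E (P * s ^ i * u) m∈ (factored i e) in
      q * u * u , ^-regular K (begin
        P * f m  ≈⟨ e′ ⟩
        P * f n + h * (P * s ^ i * u) + q * (P * s ^ i * u * (P * s ^ i * u))
          ≈⟨ +-congʳ (+-congˡ (*-congʳ cP≈h)) ⟨
        P * f n + c * P * (P * s ^ i * u) + q * (P * s ^ i * u * (P * s ^ i * u))
          ≈⟨ expand-fine P (f n) c q (s ^ i) u ⟩
        P * (f n + P * s ^ i * (c * u + s ^ i * (q * u * u)))
          ≈⟨ *-congˡ (+-congˡ (*-congʳ (^-homo-* s K i))) ⟨
        P * (f n + s ^ (K ℕ.+ i) * (c * u + s ^ i * (q * u * u)))  ∎)

    -- Preservation at the single level K + 1 + j suffices for all `i`, since divisibility of the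
    -- slope by P does not mention a level.
    linearise : ∀ j → Preserves (K ℕ.+ suc j) → ∀ {n} → n ∈ S → ∃ λ c → ∀ i → LinearTo i n c
    linearise j pres n∈ =
      let h , E = slope n∈
          c , cP≈h = slope-divisible j pres n∈ E
      in c , slope⇒linear cP≈h E

    preserves-all : ∀ j → Preserves (K ℕ.+ suc j) → ∀ i → Preserves (K ℕ.+ i)
    preserves-all j pres i m∈ n∈ m≡n =
      let u , e = ∣-⇒≈+ m≡n
          w , e′ = proj₂ (linearise j pres n∈) i u m∈ e
      in ≈+⇒∣- _ e′

    s^K+suc : ∀ i x → s ^ (K ℕ.+ suc i) * x ≈ s ^ (K ℕ.+ i) * (x * s)
    s^K+suc i x = begin
      s ^ (K ℕ.+ suc i) * x    ≡⟨ cong (λ k → s ^ k * x) (ℕ.+-suc K i) ⟩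
      s * s ^ (K ℕ.+ i) * x    ≈⟨ *-assoc s _ x ⟩
      s * (s ^ (K ℕ.+ i) * x)  ≈⟨ *-comm s _ ⟩
      s ^ (K ℕ.+ i) * x * s    ≈⟨ *-assoc _ x s ⟩
      s ^ (K ℕ.+ i) * (x * s)  ∎

    raise : ∀ i {m n x} → m ≈ n + s ^ (K ℕ.+ i) * x → s ∣ x → m ≡ n [s^ K ℕ.+ suc i ]
    raise i e (t , ts≈x) = ≈+⇒∣- t
      (trans e (+-congˡ (trans (*-congˡ (sym ts≈x)) (sym (s^K+suc i t)))))

    lower : ∀ i {m n x} → m ≈ n + s ^ (K ℕ.+ i) * x → m ≡ n [s^ K ℕ.+ suc i ] → s ∣ x
    lower i {n = n} e m≡n = let t , e′ = ∣-⇒≈+ m≡n in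
      t , sym (^-regular (K ℕ.+ i) (∙-cancelˡ n _ _
        (trans (sym e) (trans e′ (+-congˡ (s^K+suc i t))))))

    s∣s^suc*w : ∀ i w → s ∣ s ^ suc i * w
    s∣s^suc*w i w = s ^ i * w , trans (*-comm _ s) (sym (*-assoc s (s ^ i) w))

    -- With ℓ = K + 2 + j: if f(m) ≡ f(n) modulo s^(ℓ+2), then m = n + s^(ℓ+1) u with s ∣ c u.
    -- So f(n + s^ℓ u) ≡ f(n) modulo s^(ℓ+1), which forces s ∣ u.
    reflects-step : ∀ j → Preserves (K ℕ.+ suc j) → Reflects (K ℕ.+ (3 ℕ.+ j)) →
      Reflects (K ℕ.+ (4 ℕ.+ j))
    reflects-step j pres reflects {m} {n} m∈ n∈ fm≡fn =
      let c , L = linearise j pres n∈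
          u , e = ∣-⇒≈+ (reflects m∈ n∈ (weaken (ℕ.+-monoʳ-≤ K (ℕ.n≤1+n (3 ℕ.+ j))) fm≡fn))
          w , fm≈ = L (3 ℕ.+ j) u m∈ e
          s∣cu = ∣-of-sum (lower (3 ℕ.+ j) fm≈ fm≡fn) (s∣s^suc*w (2 ℕ.+ j) w) ≈-refl
          m′∈ = S-shift (K ℕ.+ (2 ℕ.+ j)) u
            (ℕ.≤-trans (ℕ.s≤s ℕ.z≤n) (ℕ.m≤n+m (2 ℕ.+ j) K)) n∈
          w′ , fm′≈ = L (2 ℕ.+ j) u m′∈ ≈-refl
          fm′≡fn = raise (2 ℕ.+ j) fm′≈ (∣-+ s∣cu (s∣s^suc*w (1 ℕ.+ j) w′))
      in raise (3 ℕ.+ j) e (lower (2 ℕ.+ j) ≈-refl (reflects m′∈ n∈ fm′≡fn))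

    -- Values congruent modulo s have equal digits `δ`, so equal terms are subtracted on both sides.
    tilde-cong : ∀ k {x y} → f x ≡ f y [s^ 1 ] → f x ≡ f y [s^ k ] → tilde f δ x ≡ tilde f δ y [s^ k ]
    tilde-cong k e₁ e = ∣-cong-+ e (≈⇒∣- (-‿cong (δ-cong e₁)))

    -- The congruence modulo s has to be supplied separately: `tilde` removes the digit, so its
    -- values cannot show whether the digits agree.
    tilde-injective : ∀ k {x y} →
      f x ≡ f y [s^ 1 ] → tilde f δ x ≡ tilde f δ y [s^ k ] → f x ≡ f y [s^ k ]
    tilde-injective k {x} {y} e₁ e = ∣ʳ-respʳ-≈
      (+-cong (//-rightDividesˡ (δ (f x)) (f x)) (-‿cong (//-rightDividesˡ (δ (f y)) (f y))))
      (∣-cong-+ e (≈⇒∣- (δ-cong e₁)))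

    -- `coarse` costs K levels and leaves at least one. This is how digits are seen to agree from
    -- level K + 1 on.
    f-cong-1 : ∀ i {m n} → m ∈ S → n ∈ S → m ≡ n [s^ K ℕ.+ suc i ] → f m ≡ f n [s^ 1 ]
    f-cong-1 i m∈ n∈ m≡n = weaken {1} {suc i} (ℕ.s≤s ℕ.z≤n) (coarse (suc i) m∈ n∈ m≡n)

    trivial : ∀ {x y} → x ≡ y [s^ 0 ]
    trivial {x} {y} = ε∣ʳ (x - y)

    -- Replacing x modulo s^(K+1+k) changes f(x) only by a multiple of s^(1+k), by `coarse`, and
    -- hence leaves its digit alone.
    to-W : ∀ k {x} → x ∈ S → ∃ λ x′ → x′ ∈ W (K ℕ.+ suc k) ×
      x ≡ x′ [s^ suc k ] × tilde f δ x ≡ tilde f δ x′ [s^ suc k ]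
    to-W k x∈ =
      let x′ , x′∈ , x≡x′ = representative (K ℕ.+ suc k)
            (ℕ.≤-trans (ℕ.s≤s ℕ.z≤n) (ℕ.m≤n+m (suc k) K)) x∈
          fx≡fx′ = coarse (suc k) x∈ (W⊆S _ x′∈) x≡x′
      in x′ , x′∈ , weaken (ℕ.m≤n+m (suc k) K) x≡x′ ,
         tilde-cong (suc k) (weaken {1} {suc k} (ℕ.s≤s ℕ.z≤n) fx≡fx′) fx≡fx′

    conjugate : ∀ {d x x′ y y′} → d ∣ x - x′ → d ∣ y - y′ → d ∣ x - y → d ∣ x′ - y′
    conjugate x≡x′ y≡y′ x≡y = ∣-trans (∣-sym x≡x′) (∣-trans x≡y y≡y′)

    conjugate⁻¹ : ∀ {d x x′ y y′} → d ∣ x - x′ → d ∣ y - y′ → d ∣ x′ - y′ → d ∣ x - y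
    conjugate⁻¹ x≡x′ y≡y′ = conjugate (∣-sym x≡x′) (∣-sym y≡y′)

    preserves-witness : ∀ k → PreservesOn f δ (W (K ℕ.+ k)) k → PreservesOn f δ S k
    -- At level 0 every congruence holds. The case is separate because K may be 0, and W_0 need not
    -- contain a representative of each element of S.
    preserves-witness zero    _                = mk-preserves λ _ _ _ _ _ → trivial
    preserves-witness (suc k) (mk-preserves w) = mk-preserves λ m n m∈ n∈ m≡n →
      let m′ , m′∈ , m≡m′ , tm≡ = to-W k m∈
          n′ , n′∈ , n≡n′ , tn≡ = to-W k n∈
      in conjugate⁻¹ tm≡ tn≡ (w m′ n′ m′∈ n′∈ (conjugate m≡m′ n≡n′ m≡n))

    reflects-witness : ∀ k →
      PreservesAndReflectsOn f δ (W (K ℕ.+ k)) k → PreservesAndReflectsOn f δ S k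
    reflects-witness zero    _ =
      mk-preserves-reflects λ _ _ _ _ → mk⇔ (λ _ → trivial) (λ _ → trivial)
    reflects-witness (suc k) (mk-preserves-reflects w) = mk-preserves-reflects λ m n m∈ n∈ →
      let m′ , m′∈ , m≡m′ , tm≡ = to-W k m∈
          n′ , n′∈ , n≡n′ , tn≡ = to-W k n∈
          w′ = w m′ n′ m′∈ n′∈
      in mk⇔ (conjugate⁻¹ tm≡ tn≡ ∘ Equivalence.to w′ ∘ conjugate m≡m′ n≡n′)
             (conjugate⁻¹ m≡m′ n≡n′ ∘ Equivalence.from w′ ∘ conjugate tm≡ tn≡)

    preserves-f : ∀ j → PreservesOn f δ S (K ℕ.+ suc j) → Preserves (K ℕ.+ suc j)
    preserves-f j (mk-preserves pres) m∈ n∈ m≡n =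
      tilde-injective (K ℕ.+ suc j) (f-cong-1 j m∈ n∈ m≡n) (pres _ _ m∈ n∈ m≡n)

    -- The levels `i` and `j` are unrelated: from K + 1 on, preservation transfers downwards as well
    -- as upwards, because it is equivalent to a condition on slopes.
    preserves-level : ∀ j i → PreservesOn f δ S (K ℕ.+ suc j) → PreservesOn f δ S (K ℕ.+ suc i)
    preserves-level j i pres = mk-preserves λ m n m∈ n∈ m≡n →
      tilde-cong (K ℕ.+ suc i) (f-cong-1 i m∈ n∈ m≡n)
      (preserves-all j (preserves-f j pres) (suc i) m∈ n∈ m≡n)

    suitable-step : ∀ j → PreservesOn f δ S (K ℕ.+ (2 ℕ.+ j)) →
      PreservesAndReflectsOn f δ S (K ℕ.+ (3 ℕ.+ j)) → PreservesAndReflectsOn f δ S (K ℕ.+ (4 ℕ.+ j))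
    suitable-step j pres (mk-preserves-reflects suit) = mk-preserves-reflects λ m n m∈ n∈ →
      mk⇔ (PreservesOn.preserves (preserves-level (suc j) (3 ℕ.+ j) pres) m n m∈ n∈) λ tm≡tn →
        -- The digits must be shown equal before f can replace `tilde`. Reflection one level lower
        -- gives m ≡ n modulo s^(K+3+j), which is enough for `f-cong-1`.
        let m≡n = Equivalence.from (suit m n m∈ n∈)
              (weaken (ℕ.+-monoʳ-≤ K (ℕ.n≤1+n (3 ℕ.+ j))) tm≡tn)
        in reflects-step j (preserves-f j (preserves-level (suc j) j pres)) reflects m∈ n∈
             (tilde-injective (K ℕ.+ (4 ℕ.+ j)) (f-cong-1 (2 ℕ.+ j) m∈ n∈ m≡n) tm≡tn)
      where
      reflects : Reflects (K ℕ.+ (3 ℕ.+ j))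
      reflects {m} {n} m∈ n∈ fm≡fn = Equivalence.from (suit m n m∈ n∈)
        (tilde-cong (K ℕ.+ (3 ℕ.+ j))
          (weaken {1} (ℕ.≤-trans (ℕ.s≤s ℕ.z≤n) (ℕ.m≤n+m (3 ℕ.+ j) K)) fm≡fn) fm≡fn)

least : ∀ {ℓ} {P : Pred ℕ ℓ} → Decidable P → ∀ n → P n → ∃ (IsLeast ℕ._≤_ P)
least P? zero    Pn = 0 , Pn , λ _ → ℕ.z≤n
least {P = P} P? (suc n) Pn with P? 0
... | yes P0 = 0 , P0 , λ _ → ℕ.z≤n
... | no ¬P0 with least (P? ∘ suc) n Pn
...   | k , Pk , k-least = suc k , Pk , λ
        { {zero} P0 → contradiction P0 ¬P0 ; {suc y} Py → ℕ.s≤s (k-least Py) }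

≡0-mod⇔∣ : ∀ {n a} → a ≡ 0ℤ [mod n ] ⇔ + n ℤ∣.∣ a
≡0-mod⇔∣ {n} {a} = mk⇔ (subst (+ n ℤ∣.∣_) (ℤ.+-identityʳ a) ∘ n∣a-b)
  (mk-mod ∘ subst (+ n ℤ∣.∣_) (≡.sym (ℤ.+-identityʳ a)))
  where open _≡_[mod_]

open import Data.Nat.Base using (_+_; _≤_; _<_)

-- Passing from single levels to all levels, with `A` for weak suitability and `B` for suitability.

module Levels {a b} {A : ℕ → Set a} {B : ℕ → Set b} (K : ℕ)
  (B⇒A : ∀ ℓ → B ℓ → A ℓ)
  (A-level : ∀ j i → A (K + suc j) → A (K + suc i))
  (B-step : ∀ j → A (K + (2 + j)) → B (K + (3 + j)) → B (K + (4 + j)))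
  where

  above : ∀ k {ℓ} → K + k ≤ ℓ → ∃ λ j → K + (k + j) ≡ ℓ
  above k K+k≤ℓ = let j , e = ℕ.m≤n⇒∃[o]m+o≡n K+k≤ℓ in j , ≡.trans (≡.sym (ℕ.+-assoc K k j)) e

  shift : ∀ k i → K + k + i ≡ K + (i + k)
  shift k i = ≡.trans (ℕ.+-assoc K k i) (cong (λ n → K + n) (ℕ.+-comm k i))

  A-above : ∀ {ℓ} → K + 1 ≤ ℓ → A ℓ → ∀ {ℓ′} → K + 1 ≤ ℓ′ → A ℓ′
  A-above ℓ≥ Aℓ ℓ′≥ with above 1 ℓ≥ | above 1 ℓ′≥
  ... | j , refl | i , refl = A-level j i Aℓ

  A-suc : ∀ ℓ → K + 1 ≤ ℓ → A ℓ → A (ℓ + 1)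
  A-suc ℓ ℓ≥ Aℓ = A-above ℓ≥ Aℓ (ℕ.≤-trans ℓ≥ (ℕ.m≤m+n ℓ 1))

  B-suc : ∀ ℓ → K + 2 ≤ ℓ → A ℓ → B (ℓ + 1) → B (ℓ + 2)
  B-suc ℓ ℓ≥ Aℓ Bℓ+1 with above 2 ℓ≥
  ... | j , refl = subst B (≡.sym (shift (2 + j) 2))
    (B-step j Aℓ (subst B (shift (2 + j) 1) Bℓ+1))

  B-above : B (K + 2) → B (K + 3) → ∀ {ℓ} → K + 2 ≤ ℓ → B ℓ
  B-above B₂ B₃ ℓ≥ with above 2 ℓ≥
  ... | j , refl = proj₁ (consecutive j)
    where
    -- The step needs two preceding levels, so the induction carries a pair; `B⇒A` supplies weak
    -- suitability at the lower one.
    consecutive : ∀ j → B (K + (2 + j)) × B (K + (3 + j))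
    consecutive zero    = B₂ , B₃
    consecutive (suc j) = let b , b′ = consecutive j in b′ , B-step j (B⇒A (K + (2 + j)) b) b′

  A-bounded : (∀ ℓ → ℓ ≤ K + 1 → A ℓ) → ∀ ℓ → A ℓ
  A-bounded bounded ℓ with ℕ.≤-total ℓ (K + 1)
  ... | inj₁ ℓ≤ = bounded ℓ ℓ≤
  ... | inj₂ ℓ≥ = A-above ℕ.≤-refl (bounded (K + 1) ℕ.≤-refl) ℓ≥

  B-bounded : (∀ ℓ → ℓ ≤ K + 3 → B ℓ) → ∀ ℓ → B ℓ
  B-bounded bounded ℓ with ℕ.≤-total ℓ (K + 3)
  ... | inj₁ ℓ≤ = bounded ℓ ℓ≤
  ... | inj₂ ℓ≥ = B-above (bounded (K + 2) K+2≤K+3) (bounded (K + 3) ℕ.≤-refl)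
                    (ℕ.≤-trans K+2≤K+3 ℓ≥)
    where
    K+2≤K+3 : K + 2 ≤ K + 3
    K+2≤K+3 = ℕ.+-monoʳ-≤ K (ℕ.n≤1+n 2)

shift-identity : ∀ r s c S u →
  r ℤ.+ s ℤ.* c ℤ.+ s ℤ.* S ℤ.* u ≡ r ℤ.+ s ℤ.* (c ℤ.+ S ℤ.* u)
shift-identity = ℤ-Solver.solve-∀

-- Divisibility, digits and residues in ℤₚ.

module PadicProperties (p : ℕ) .{{_ : NonTrivial p}} where
  open Padic p
  open Congruences ℤₚ-commutativeRing using (∣-⇒≈+; ∣-sym)
  open _≡_[mod_]
  open import Algebra.Properties.Semiring.Divisibility Zₚ.semiring using (_,_)

  private instance
    p≢0 : NonZero p
    p≢0 = ℕ.nonTrivial⇒nonZero p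

  proj-^ : ∀ N k → proj (fromℕ p ^ₚ N) k ≡ + (p ℕ.^ N)
  proj-^ zero    k = refl
  proj-^ (suc N) k = ≡.trans (cong (+ p ℤ.*_) (proj-^ N k)) (≡.sym (ℤ.pos-* p (p ℕ.^ N)))

  compatible+ : ∀ z N k → proj z (k + N) ≡ proj z N [mod p ℕ.^ N ]
  compatible+ z N zero    = mod-reflexive refl
  compatible+ z N (suc k) = mod-trans
    (mod-weaken (p ℕ.^ k) (p ℕ.^ N)
      (subst (proj z (suc k + N) ≡ proj z (k + N) [mod_]) (ℕ.^-distribˡ-+-* p k N)
        (compatible z (k + N))))
    (compatible+ z N k)

  ∣ₚ⇒proj∣ : ∀ N {z} → fromℕ p ^ₚ N ∣ₚ z → + (p ℕ.^ N) ℤ∣.∣ proj z N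
  ∣ₚ⇒proj∣ N {z} (q , e) = Equivalence.to ≡0-mod⇔∣ (mod-trans (mod-sym (proj-≈ e N))
    (Equivalence.from ≡0-mod⇔∣ (divides (proj q N) (cong (proj q N ℤ.*_) (proj-^ N N)))))

  -- Division by p^N costs N digits of precision, so component `k` of the quotient is read off from
  -- component `k + N` of `z`. Compatibility follows by cancelling p^N from a congruence modulo
  -- p^(N+k).
  proj∣⇒∣ₚ : ∀ N {z} → + (p ℕ.^ N) ℤ∣.∣ proj z N → fromℕ p ^ₚ N ∣ₚ z
  proj∣⇒∣ₚ N {z} d = mkℤₚ q q-compatible , mk-≈ₚ λ k →
    mod-trans (mod-reflexive (≡.trans (cong (q k ℤ.*_) (proj-^ N k)) (≡.sym (q-eq k))))
      (subst (λ n → proj z n ≡ proj z k [mod p ℕ.^ k ]) (ℕ.+-comm N k) (compatible+ z k N))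
    where
    d′ : ∀ k → + (p ℕ.^ N) ℤ∣.∣ proj z (k + N)
    d′ k = Equivalence.to ≡0-mod⇔∣ (mod-trans (compatible+ z N k) (Equivalence.from ≡0-mod⇔∣ d))

    q : ℕ → ℤ
    q k = ℤ∣._∣_.quotient (d′ k)

    q-eq : ∀ k → proj z (k + N) ≡ q k ℤ.* + (p ℕ.^ N)
    q-eq k = ℤ∣._∣_.equality (d′ k)

    q-eq′ : ∀ k → proj z (k + N) ≡ + (p ℕ.^ N) ℤ.* q k
    q-eq′ k = ≡.trans (q-eq k) (ℤ.*-comm (q k) _)

    q-compatible : ∀ k → q (suc k) ≡ q k [mod p ℕ.^ k ]
    q-compatible k = mod-cancel (p ℕ.^ N) (p ℕ.^ k) {{ℕ.m^n≢0 p N}}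
      (mod-trans (mod-reflexive (≡.sym (q-eq′ (suc k))))
      (mod-trans (subst (proj z (suc k + N) ≡ proj z (k + N) [mod_])
          (≡.trans (cong (p ℕ.^_) (ℕ.+-comm k N)) (ℕ.^-distribˡ-+-* p N k))
          (compatible z (k + N)))
        (mod-reflexive (q-eq′ k))))

  p^_∣ₚ?_ : ∀ N z → Dec (fromℕ p ^ₚ N ∣ₚ z)
  p^ N ∣ₚ? z = map′ (proj∣⇒∣ₚ N) (∣ₚ⇒proj∣ N) (+ (p ℕ.^ N) ℤ∣.∣? proj z N)

  residue-cong : ∀ N {x y} → x ≡ y [mod-p^ N ] → residue x N ≡ residue y N
  residue-cong N {x} {y} x≡y = ≡.trans
    (≡.sym (ℕ.m<n⇒m%n≡m (ℤ.n%ℕd<d (proj x N) (p ℕ.^ N))))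
    (%-unique (p ℕ.^ N)
      (mod-trans (mod-sym (mod-%ℕ (proj x N) (p ℕ.^ N)))
        (mod-trans (mk-mod (∣ₚ⇒proj∣ N x≡y)) (mod-%ℕ (proj y N) (p ℕ.^ N))))
      (ℤ.n%ℕd<d (proj y N) (p ℕ.^ N)))
    where
    instance
      p^N≢0 : NonZero (p ℕ.^ N)
      p^N≢0 = ℕ.m^n≢0 p N

  %p-cong : ∀ {x y} → x ≡ y [mod-p^ 1 ] → x %p ≡ y %p
  %p-cong {x} {y} e = cong (ℕ._/ 1) (residue-cong 1 {x} {y} e)

  module D = Divided ℤₚ-commutativeRing (fromℕ p) (λ {x} {y} → fromℕ-p-regular {x} {y})

  -- From here on, equalities in ℤₚ are taken apart and rebuilt: conversion checking then only
  -- involves the integers proj x k and not the compatibility proofs.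
  to-D : ∀ ℓ {x y} → x ≡ y [mod-p^ ℓ ] → x D.≡ y [s^ ℓ ]
  to-D ℓ (q , mk-≈ₚ e) = q , mk-≈ₚ e

  from-D : ∀ ℓ {x y} → x D.≡ y [s^ ℓ ] → x ≡ y [mod-p^ ℓ ]
  from-D ℓ (q , mk-≈ₚ e) = q , mk-≈ₚ e

  +pℤₚ-shift : ∀ r {n} k u → 1 ≤ k → n ∈ r +pℤₚ → n Zₚ.+ fromℕ p D.^ k Zₚ.* u ∈ r +pℤₚ
  +pℤₚ-shift r {n} (suc k) u _ (c , mk-≈ₚ e) =
    -- If n = r + p c, the shifted element is r + p (c + p^k u), with `k` one less than the original
    -- exponent.
    mkℤₚ (λ j → proj c j ℤ.+ proj (fromℕ p D.^ k) j ℤ.* proj u j)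
      (λ j → mod-+ (compatible c j) (mod-* (compatible (fromℕ p D.^ k) j) (compatible u j))) ,
    mk-≈ₚ λ j → mod-trans (mod-+ (e j) (mod-reflexive refl))
      (mod-reflexive (shift-identity (+ r) (+ p) (proj c j) (proj (fromℕ p D.^ k) j) (proj u j)))

  residue-≡ : ∀ N x → x D.≡ fromℕ (residue x N) [s^ N ]
  residue-≡ N x = to-D N {x} {fromℕ (residue x N)} (proj∣⇒∣ₚ N {x Zₚ.- fromℕ (residue x N)}
    (n∣a-b (mod-%ℕ (proj x N) (p ℕ.^ N) {{ℕ.m^n≢0 p N}})))

  digit₀ : ℤₚ → ℤₚ
  digit₀ x = fromℕ (x %p)

  digit₀-cong : ∀ {x y} → x D.≡ y [s^ 1 ] → digit₀ x ≈ₚ digit₀ y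
  digit₀-cong {x} {y} e = mk-≈ₚ λ k → mod-reflexive
    (cong +_ (%p-cong {x} {y} (from-D 1 {x} {y} e)))

  +pℤₚ-resp-≡ : ∀ r {N x y} → 1 ≤ N → x D.≡ y [s^ N ] → x ∈ r +pℤₚ → y ∈ r +pℤₚ
  +pℤₚ-resp-≡ r {N} {x} {y} 1≤N x≡y x∈ =
    let u , mk-≈ₚ e = ∣-⇒≈+ {fromℕ p D.^ N} {y} {x} (∣-sym {fromℕ p D.^ N} {x} {y} x≡y)
        c , mk-≈ₚ e′ = +pℤₚ-shift r N u 1≤N x∈
    in c , mk-≈ₚ (λ k → mod-trans (e k) (e′ k))

  representative : ∀ r N {x} → 1 ≤ N → x ∈ r +pℤₚ → ∃ λ x′ → x′ ∈ W r N × x D.≡ x′ [s^ N ]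
  representative r N {x} 1≤N x∈ =
    fromℕ (residue x N) ,
    ( (residue x N , ℤ.n%ℕd<d (proj x N) (p ℕ.^ N) {{ℕ.m^n≢0 p N}} , mk-≈ₚ (λ _ → mod-reflexive refl))
    , +pℤₚ-resp-≡ r {N} {x} {fromℕ (residue x N)} 1≤N (residue-≡ N x) x∈) ,
    residue-≡ N x

  -- Integrality in ℚₚ and valuations of the coefficients.

  integral⇒D : ∀ {x} → Integral x → D.Integral x
  integral⇒D (w , mk-≈ᶠ (mk-≈ₚ c)) = w , mk-≈ᶠ (mk-≈ₚ c)

  -- z/p^e is integral exactly when p^e divides z, and this is decided by a single component of z.
  integral? : ∀ x → Dec (D.Integral x)
  integral? (z /p^ e) = map′
    (λ { (q , mk-≈ₚ c) → q , mk-≈ᶠ (mk-≈ₚ λ k →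
      mod-trans (mod-reflexive (ℤ.*-identityʳ (proj z k))) (mod-sym (c k))) })
    (λ { (q , mk-≈ᶠ (mk-≈ₚ c)) → q , mk-≈ₚ λ k →
      mod-trans (mod-sym (c k)) (mod-reflexive (ℤ.*-identityʳ (proj z k))) })
    (p^ e ∣ₚ? z)

  scaledIntegral? : ∀ x k → Dec (D.ScaledIntegral x k)
  scaledIntegral? x k = map′ D.mk-scaled D.ScaledIntegral.integral (integral? (D.scaled x k))

  IsLeastDenominator : ℚₚ → ℕ → Set
  IsLeastDenominator x = IsLeast ℕ._≤_ (λ k → 1 ≤ k × D.ScaledIntegral x k)

  least-denominator : ∀ x → ∃ (IsLeastDenominator x)
  -- The search starts from `suc e`: the fraction's own exponent `e` clears it but may be 0, whereas
  -- `ν-fraction` asks for a positive exponent.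
  least-denominator x = least (λ k → (1 ℕ.≤? k) ×-dec scaledIntegral? x k) (suc e)
    (ℕ.s≤s ℕ.z≤n , D.integral-scale x {e} {suc e} (ℕ.n≤1+n e) (D.exponent-clears x))
    where e = ℚₚ.exponent x

  ν-nonintegral : ∀ {x k} → ¬ D.Integral x → IsLeastDenominator x k → ν x ≔ [ ℤ.- + k ]
  ν-nonintegral ¬int ((1≤k , D.mk-scaled (w , mk-≈ᶠ (mk-≈ₚ c))) , k-least) =
    ν-fraction (¬int ∘ integral⇒D)
    ( (1≤k , w , mk-≈ᶠ (mk-≈ₚ c))
    , λ { (1≤y , v , mk-≈ᶠ (mk-≈ₚ b)) → k-least (1≤y , D.mk-scaled (v , mk-≈ᶠ (mk-≈ₚ b))) })

  -- Valuations are not computable, but integrality is decidable. An integral x needs no clearing;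
  -- otherwise its least denominator exponent k can be found, x has valuation -k, and the bound
  -- gives k ≤ K.
  ν-bound⇒scaledIntegral : ∀ x K → (∀ {k} → ν x ≔ [ ℤ.- + k ] → k ≤ K) → D.ScaledIntegral x K
  ν-bound⇒scaledIntegral x K ν-bound =
    [ D.integral⇒scaled x K , nonintegral (least-denominator x) ]′ (Dec.toSum (integral? x))
    where
    nonintegral : ∃ (IsLeastDenominator x) → ¬ D.Integral x → D.ScaledIntegral x K
    nonintegral (k , isLeast) ¬int =
      D.integral-scale x {k} {K} (ν-bound (ν-nonintegral ¬int isLeast)) (proj₂ (proj₁ isLeast))

  coefficients-scaledIntegral : ∀ {d} (a : Vector ℚₚ (suc d)) {K} → IsDenominatorExponent a K →
    ∀ i → D.ScaledIntegral (a i) K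
  coefficients-scaledIntegral a {K} (_ , -K≤) i = ν-bound⇒scaledIntegral (a i) K λ ν≔ →
    -- Minimality of -K among the valuations gives -K ≤ -k, that is, k ≤ K.
    ℤ.drop‿+≤+ (ℤ.neg-cancel-≤ ([≤]-injective (-K≤ (inj₁ (i , ν≔)))))

  ≈⇒≈ᴰ : ∀ {x y} → x Qₚ.≈ y → x D.Q.≈ y
  ≈⇒≈ᴰ e = e

  fromℤₚ≈embed : ∀ x → fromℤₚ x D.Q.≈ D.embed x
  fromℤₚ≈embed x = mk-≈ᶠ (mk-≈ₚ λ k → mod-reflexive refl)

  value : ∀ {d} (a : Vector ℚₚ (suc d)) x y → fromℤₚ y Qₚ.≈ eval a (fromℤₚ x) → D.Value a x y
  value a x y e = D.value a (fromℤₚ≈embed y) (fromℤₚ≈embed x) (≈⇒≈ᴰ e)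

  setting : ∀ r (f : Map) {d} (a : Vector ℚₚ (suc d)) {K} →
    (∀ n → n ∈ r +pℤₚ → fromℤₚ (f ⟨$⟩ n) Qₚ.≈ eval a (fromℤₚ n)) →
    IsDenominatorExponent a K → D.Setting (r +pℤₚ) (W r) (f ⟨$⟩_) digit₀ a K
  setting r f a f≈ denominator = record
    { S-shift        = λ k u 1≤k n∈ → let c , mk-≈ₚ e = +pℤₚ-shift r k u 1≤k n∈ in c , mk-≈ₚ e
    ; a-scaled       = coefficients-scaledIntegral a denominator
    ; f-value        = λ {n} n∈ → value a n (f ⟨$⟩ n) (f≈ n n∈)
    ; δ-cong         = λ { {x} {y} (q , mk-≈ₚ e) → digit₀-cong {x} {y} (q , mk-≈ₚ e) }
    ; W⊆S            = λ _ → proj₂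
    ; representative = λ N {x} 1≤N x∈ →
        let x′ , x′∈ , (q , mk-≈ₚ e) = representative r N {x} 1≤N x∈ in
        x′ , x′∈ , (q , mk-≈ₚ e)
    }

  -- Every opening of Padic p yields its own copy of fromℤₚ, and the conversion checker cannot
  -- identify eval a (fromℤₚ n) for two copies without comparing compatibility proofs. Hence
  -- _~_, which ignores these proofs and can be checked coefficient by coefficient.
  infix 4 _~_

  _~_ : ℚₚ → ℚₚ → Set
  x ~ y = ℚₚ.exponent x ≡ ℚₚ.exponent y ×
    (∀ k → proj (ℚₚ.numerator x) k ≡ proj (ℚₚ.numerator y) k)

  +-~ : ∀ x {y z} → y ~ z → (x Qₚ.+ y) ~ (x Qₚ.+ z)
  +-~ x {y} {z} (e , q) = cong (λ j → ℚₚ.exponent x + j) e , λ k →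
    cong₂ (λ j v → proj (ℚₚ.numerator x) k ℤ.* proj (fromℕ p ^ₚ j) k
      ℤ.+ v ℤ.* proj (fromℕ p ^ₚ ℚₚ.exponent x) k)
      e (q k)

  sum-~ : ∀ n {t u : Vector ℚₚ n} → (∀ i → t i ~ u i) → sum t ~ sum u
  sum-~ zero    h = refl , λ _ → refl
  sum-~ (suc n) {t} {u} h =
    let e , q = h Fin.zero
        e′ , q′ = sum-~ n {t ∘ Fin.suc} {u ∘ Fin.suc} (h ∘ Fin.suc) in
    cong₂ _+_ e e′ , λ k → cong₂ ℤ._+_
      (cong₂ (λ v j → v ℤ.* proj (fromℕ p ^ₚ j) k) (q k) e′)
      (cong₂ (λ v j → v ℤ.* proj (fromℕ p ^ₚ j) k) (q′ k) e)

  cons-~ : ∀ x n {t u : Vector ℚₚ n} → (∀ i → t i ~ u i) → (x Qₚ.+ sum t) ~ (x Qₚ.+ sum u)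
  cons-~ x n {t} {u} h = +-~ x {sum t} {sum u} (sum-~ n {t} {u} h)

  ~-resp-≈ : ∀ {x x₁ y y₁} → x ~ x₁ → y ~ y₁ → x Qₚ.≈ y → x₁ Qₚ.≈ y₁
  ~-resp-≈ (e , q) (e′ , q′) (mk-≈ᶠ (mk-≈ₚ c)) = mk-≈ᶠ (mk-≈ₚ λ k →
    subst₂ (λ u v → u ≡ v [mod p ℕ.^ k ])
      (cong₂ (λ v j → v ℤ.* proj (fromℕ p ^ₚ j) k) (q k) e′)
      (cong₂ (λ v j → v ℤ.* proj (fromℕ p ^ₚ j) k) (q′ k) e)
      (c k))

  fromℤₚ-eval-resp-~ : ∀ {d} (a : Vector ℚₚ (suc d)) n y {y′ x′} →
    y′ Qₚ.≈ x′ → y′ ~ fromℤₚ y → x′ ~ eval a (fromℤₚ n) → fromℤₚ y Qₚ.≈ eval a (fromℤₚ n)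
  fromℤₚ-eval-resp-~ a n y e y~ x~ = ~-resp-≈ y~ x~ e

  -- Transfer between the p-adic notions and the abstract ones.

  preservesOn⇒D : ∀ f T ℓ → PreservesOn T f ℓ → D.PreservesOn (f ⟨$⟩_) digit₀ T ℓ
  preservesOn⇒D f T ℓ h = D.mk-preserves λ { m n m∈ n∈ (q , mk-≈ₚ e) →
    let q′ , mk-≈ₚ e′ = h m n m∈ n∈ (q , mk-≈ₚ e) in q′ , mk-≈ₚ e′ }

  D⇒preservesOn : ∀ f T ℓ → D.PreservesOn (f ⟨$⟩_) digit₀ T ℓ → PreservesOn T f ℓ
  D⇒preservesOn f T ℓ (D.mk-preserves h) m n m∈ n∈ (q , mk-≈ₚ e) =
    let q′ , mk-≈ₚ e′ = h m n m∈ n∈ (q , mk-≈ₚ e) in q′ , mk-≈ₚ e′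

  preservesAndReflectsOn⇒D : ∀ f T ℓ →
    PreservesAndReflectsOn T f ℓ → D.PreservesAndReflectsOn (f ⟨$⟩_) digit₀ T ℓ
  preservesAndReflectsOn⇒D f T ℓ h = D.mk-preserves-reflects λ m n m∈ n∈ → mk⇔
    (λ { (q , mk-≈ₚ e) →
      let q′ , mk-≈ₚ e′ = Equivalence.to (h m n m∈ n∈) (q , mk-≈ₚ e) in q′ , mk-≈ₚ e′ })
    (λ { (q , mk-≈ₚ e) →
      let q′ , mk-≈ₚ e′ = Equivalence.from (h m n m∈ n∈) (q , mk-≈ₚ e) in q′ , mk-≈ₚ e′ })

  D⇒preservesAndReflectsOn : ∀ f T ℓ →
    D.PreservesAndReflectsOn (f ⟨$⟩_) digit₀ T ℓ → PreservesAndReflectsOn T f ℓ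
  D⇒preservesAndReflectsOn f T ℓ (D.mk-preserves-reflects h) m n m∈ n∈ = mk⇔
    (λ { (q , mk-≈ₚ e) →
      let q′ , mk-≈ₚ e′ = Equivalence.to (h m n m∈ n∈) (q , mk-≈ₚ e) in q′ , mk-≈ₚ e′ })
    (λ { (q , mk-≈ₚ e) →
      let q′ , mk-≈ₚ e′ = Equivalence.from (h m n m∈ n∈) (q , mk-≈ₚ e) in q′ , mk-≈ₚ e′ })

  -- The criteria over the p-adic integers.

  module Criteria (r : ℕ) (f : Map) {d} (a : Vector ℚₚ (suc d)) (K : ℕ)
    (s : D.Setting (r +pℤₚ) (W r) (f ⟨$⟩_) digit₀ a K) where
    private
      module S = D.Suitability s

    preserves-witness : ∀ k → PreservesOn (W r (K + k)) f k → PreservesOn (r +pℤₚ) f k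
    preserves-witness k w =
      D⇒preservesOn f (r +pℤₚ) k (S.preserves-witness k (preservesOn⇒D f (W r (K + k)) k w))

    reflects-witness : ∀ k →
      PreservesAndReflectsOn (W r (K + k)) f k → PreservesAndReflectsOn (r +pℤₚ) f k
    reflects-witness k w =
      D⇒preservesAndReflectsOn f (r +pℤₚ) k
        (S.reflects-witness k (preservesAndReflectsOn⇒D f (W r (K + k)) k w))

    preserves-level : ∀ j i →
      PreservesOn (r +pℤₚ) f (K + suc j) → PreservesOn (r +pℤₚ) f (K + suc i)
    preserves-level j i w =
      D⇒preservesOn f (r +pℤₚ) (K + suc i)
        (S.preserves-level j i (preservesOn⇒D f (r +pℤₚ) (K + suc j) w))

    suitable-step : ∀ j → PreservesOn (r +pℤₚ) f (K + (2 + j)) →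
      PreservesAndReflectsOn (r +pℤₚ) f (K + (3 + j)) →
      PreservesAndReflectsOn (r +pℤₚ) f (K + (4 + j))
    suitable-step j w w′ = D⇒preservesAndReflectsOn f (r +pℤₚ) (K + (4 + j)) (S.suitable-step j
      (preservesOn⇒D f (r +pℤₚ) (K + (2 + j)) w)
      (preservesAndReflectsOn⇒D f (r +pℤₚ) (K + (3 + j)) w′))

  -- The conclusions are proved here over the copy of `Padic p` opened in this module; `theorem4p10`
  -- carries the equation f = g over from its own copy.
  suitability-criteria : (r : ℕ)
    (f : Map) (d : ℕ) (a : Vector ℚₚ (suc d)) →
    (∀ n → n ∈ r +pℤₚ → fromℤₚ (f ⟨$⟩ n) Qₚ.≈ eval a (fromℤₚ n)) →
    (k K : ℕ) → IsDenominatorExponent a K →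
    (WeaklySuitableAt r f ｛ k ｝ ⇔ PreservesOn (W r (K + k)) f k)
    ×
    (SuitableAt r f ｛ k ｝ ⇔ PreservesAndReflectsOn (W r (K + k)) f k)
    ×
    ((∀ ℓ → K + 1 ≤ ℓ → WeaklySuitableAt r f ｛ ℓ ｝ → WeaklySuitableAt r f ｛ ℓ + 1 ｝)
    × (WeaklySuitableAt r f (λ ℓ → K + 1 ≤ ℓ) ⇔ WeaklySuitableAt r f ｛ K + 1 ｝))
    ×
    ((∀ ℓ → K + 2 ≤ ℓ → WeaklySuitableAt r f ｛ ℓ ｝ → SuitableAt r f ｛ ℓ + 1 ｝ →
    SuitableAt r f ｛ ℓ + 2 ｝)
    × (SuitableAt r f (λ ℓ → K + 2 ≤ ℓ) ⇔ SuitableAt r f (｛ K + 2 ｝ ∪ ｛ K + 3 ｝)))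
    ×
    ((WeaklySuitable r f ⇔ WeaklySuitableAt r f (λ ℓ → ℓ ≤ K + 1))
    × (WeaklySuitableAt r f (λ ℓ → ℓ ≤ K + 1)
    ⇔ (∀ ℓ → ℓ ≤ K + 1 → PreservesOn (W r (K + ℓ)) f ℓ)))
    ×
    ((Suitable r f ⇔ SuitableAt r f (λ ℓ → ℓ ≤ K + 3))
    × (SuitableAt r f (λ ℓ → ℓ ≤ K + 3)
    ⇔ (∀ ℓ → ℓ ≤ K + 3 → PreservesAndReflectsOn (W r (K + ℓ)) f ℓ)))
  suitability-criteria r f d a f≈ k K denominator =
      mk⇔ (λ h → restrict-A k (h k refl)) (λ { w _ refl → preserves-witness k w })
    , mk⇔ (λ h → restrict-B k (h k refl)) (λ { w _ refl → reflects-witness k w })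
    , ( (λ { ℓ ℓ≥ h _ refl → A-suc ℓ ℓ≥ (h ℓ refl) })
      , mk⇔ (λ { h _ refl → h (K + 1) ℕ.≤-refl })
            (λ h ℓ ℓ≥ → A-above ℕ.≤-refl (h (K + 1) refl) ℓ≥))
    , ( (λ { ℓ ℓ≥ h h′ _ refl → B-suc ℓ ℓ≥ (h ℓ refl) (h′ (ℓ + 1) refl) })
      , mk⇔ (λ { h _ (inj₁ refl) → h (K + 2) ℕ.≤-refl
               ; h _ (inj₂ refl) → h (K + 3) (ℕ.+-monoʳ-≤ K (ℕ.n≤1+n 2)) })
            (λ h ℓ ℓ≥ → B-above (h (K + 2) (inj₁ refl)) (h (K + 3) (inj₂ refl)) ℓ≥))
    , ( mk⇔ (λ h ℓ _ → h ℓ _) (λ h ℓ _ → A-bounded h ℓ)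
      , mk⇔ (λ h ℓ ℓ≤ → restrict-A ℓ (h ℓ ℓ≤)) (λ w ℓ ℓ≤ → preserves-witness ℓ (w ℓ ℓ≤)))
    , ( mk⇔ (λ h ℓ _ → h ℓ _) (λ h ℓ _ → B-bounded h ℓ)
      , mk⇔ (λ h ℓ ℓ≤ → restrict-B ℓ (h ℓ ℓ≤)) (λ w ℓ ℓ≤ → reflects-witness ℓ (w ℓ ℓ≤)))
    where
    s : D.Setting (r +pℤₚ) (W r) (f ⟨$⟩_) digit₀ a K
    s = setting r f a f≈ denominator

    restrict-A : ∀ ℓ → PreservesOn (r +pℤₚ) f ℓ → PreservesOn (W r (K + ℓ)) f ℓ
    restrict-A ℓ h m n m∈ n∈ = h m n (proj₂ m∈) (proj₂ n∈)

    restrict-B : ∀ ℓ → PreservesAndReflectsOn (r +pℤₚ) f ℓ → PreservesAndReflectsOn (W r (K + ℓ)) f ℓ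
    restrict-B ℓ h m n m∈ n∈ = h m n (proj₂ m∈) (proj₂ n∈)

    open Criteria r f a K s
    open Levels {A = PreservesOn (r +pℤₚ) f} {B = PreservesAndReflectsOn (r +pℤₚ) f} K
      (λ ℓ h m n m∈ n∈ → Equivalence.to (h m n m∈ n∈)) preserves-level suitable-step

theorem4p10 : (p : ℕ) .{{_ : NonTrivial p}} → let open Padic p in
    (r : ℕ) → r < p →
    (f : Map) (d : ℕ) (a : Vector ℚₚ (suc d)) →
    (∀ n → n ∈ r +pℤₚ → eval a (fromℤₚ n) ∈ Integral) →
    (∀ n → n ∈ r +pℤₚ → fromℤₚ (f ⟨$⟩ n) Qₚ.≈ eval a (fromℤₚ n)) →
    (k K : ℕ) → IsDenominatorExponent a K →
    (WeaklySuitableAt r f ｛ k ｝ ⇔ PreservesOn (W r (K + k)) f k)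
    ×
    (SuitableAt r f ｛ k ｝ ⇔ PreservesAndReflectsOn (W r (K + k)) f k)
    ×
    ((∀ ℓ → K + 1 ≤ ℓ → WeaklySuitableAt r f ｛ ℓ ｝ → WeaklySuitableAt r f ｛ ℓ + 1 ｝)
    × (WeaklySuitableAt r f (λ ℓ → K + 1 ≤ ℓ) ⇔ WeaklySuitableAt r f ｛ K + 1 ｝))
    ×
    ((∀ ℓ → K + 2 ≤ ℓ → WeaklySuitableAt r f ｛ ℓ ｝ → SuitableAt r f ｛ ℓ + 1 ｝ →
    SuitableAt r f ｛ ℓ + 2 ｝)
    × (SuitableAt r f (λ ℓ → K + 2 ≤ ℓ) ⇔ SuitableAt r f (｛ K + 2 ｝ ∪ ｛ K + 3 ｝)))
    ×
    ((WeaklySuitable r f ⇔ WeaklySuitableAt r f (λ ℓ → ℓ ≤ K + 1))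
    × (WeaklySuitableAt r f (λ ℓ → ℓ ≤ K + 1)
    ⇔ (∀ ℓ → ℓ ≤ K + 1 → PreservesOn (W r (K + ℓ)) f ℓ)))
    ×
    ((Suitable r f ⇔ SuitableAt r f (λ ℓ → ℓ ≤ K + 3))
    × (SuitableAt r f (λ ℓ → ℓ ≤ K + 3)
    ⇔ (∀ ℓ → ℓ ≤ K + 3 → PreservesAndReflectsOn (W r (K + ℓ)) f ℓ)))
theorem4p10 p r _ f d a _ f≈ = suitability-criteria r f d a λ n n∈ →
  fromℤₚ-eval-resp-~ a n (f ⟨$⟩ n) (f≈ n n∈) (refl , λ _ → refl)
    -- Both copies share the constant term a₀·x⁰ = a₀·1. The remaining `d` terms agree componentwise
    -- by computation.
    (cons-~ (a Fin.zero Qₚ.* Qₚ.1#) d (λ _ → refl , λ _ → refl))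
  where
  open Padic p
  open PadicProperties p
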